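{- Let $(\mathcal{M},\mathfrak{X})$ be a model of $\mathsf{GB}^{+\infty}$ or of $\mathsf{GB}^{ -\infty}$, and suppose $\mathcal{M}$ is $\omega$-nonstandard. Each of the following conditions implies that $\mathsf{C}_{\mathsf{Most}}^{(\mathcal{M},\mathfrak{X})}$ equals the standard cut of $\mathcal{M}$ (the set of standard elements of $\omega^{\mathcal{M}}$): (a) $\mathfrak{X}=\mathfrak{X}_{\mathsf{Def}(\mathcal{M})}$, the collection of subsets of $M$ definable in $\mathcal{M}$ with parameters; (b) $\mathcal{M}$ is not recursively saturated.
   Context: Models of the two-sorted theories are written $(\mathcal{M},\mathfrak{X})$ with $\mathfrak{X}$ a collection of subsets of $M$. $\mathsf{GB}^{+\infty}=\mathsf{GB}$ (Gödel–Bernays); $\mathsf{GB}^{ -\infty}=\mathsf{GB}_{\mathsf{fin}}+\mathsf{TC}$ ($\mathsf{GB}$ with infinity replaced by its negation, plus existence of transitive closures). $\mathcal{M}$ is $\omega$-nonstandard if its finite ordinals $\omega^{\mathcal{M}}$ include nonstandard elements. Inside the model: $c_a$ is a constant naming $a$; $\mathsf{depth}(\varphi)$ is the length of the longest path in the parsing tree of $\varphi$; $\mathsf{Depth}_k$ is the set of $\mathcal{L}_{\mathsf{ZF}}$-formulas of depth $\le k$. A class $T$ is a $\mathsf{Depth}_k$-truth class over $(V,\in)$ if $T$ consists of sentences obtained by substituting constants $c_a$ into formulas in $\mathsf{Depth}_k$, and for such sentences: $\ulcorner c_a=c_b\urcorner\in T\leftrightarrow a=b$, $\ulcorner c_a\in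 c_b\urcorner\in T\leftrightarrow a\in b$, $\neg\psi\in T\leftrightarrow\psi\notin T$, $(\psi_1\vee\psi_2)\in T\leftrightarrow(\psi_1\in T\vee\psi_2\in T)$, $\exists v\,\psi(v)\in T\leftrightarrow\exists x\,\psi(c_x)\in T$. $\mathsf{C}_{\mathsf{Most}}^{(\mathcal{M},\mathfrak{X})}$ is the set of $k\in\omega^{\mathcal{M}}$ such that some $T\in\mathfrak{X}$ is a $\mathsf{Depth}_k$-truth class over $\mathcal{M}$. -}

module Defs where

open import Level using (Level; _⊔_; 0ℓ) renaming (suc to lsuc)
open import Data.Nat using (ℕ; zero; suc; _+_; _<_)
open import Data.Fin using (Fin; toℕ)
open import Data.Vec using (Vec; []; _∷_; lookup)
open import Data.Vec.Relation.Unary.All using () renaming (All to AllVec)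
open import Data.Vec.Relation.Binary.Pointwise.Inductive using (Pointwise)
open import Data.List using (List)
open import Data.List.Relation.Unary.All using (All)
open import Data.Product using (Σ; ∃; ∃-syntax; _×_; _,_)
open import Data.Sum using (_⊎_)
open import Function.Bundles using (_⇔_)
open import Relation.Binary.Core using (Rel)
open import Relation.Binary.PropositionalEquality using (_≡_)
open import Relation.Nullary using (¬_)
open import Relation.Unary using (Pred; _∈_; _⊆_; _≐_)

------------------------------------------------------------------------
-- First-order formulas

infix 6 _≈̇_ _∈̇_ _∈ᶜ_
infix 5 ¬̇_
infixr 4 _∨̇_

-- Formulas with c class variables and n free set variables (de Bruijn);
-- only set variables are quantified.
data Fml (c : ℕ) : ℕ → Set where
  _≈̇_ : ∀ {n} → Fin n → Fin n → Fml c n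
  _∈̇_ : ∀ {n} → Fin n → Fin n → Fml c n
  _∈ᶜ_ : ∀ {n} → Fin n → Fin c → Fml c n
  ¬̇_  : ∀ {n} → Fml c n → Fml c n
  _∨̇_ : ∀ {n} → Fml c n → Fml c n → Fml c n
  ∃̇_  : ∀ {n} → Fml c (suc n) → Fml c n

LZF : ℕ → Set
LZF = Fml 0

------------------------------------------------------------------------
-- Recursive sets

data Rec : ℕ → Set where
  zeroᴿ : ∀ {n} → Rec n
  sucᴿ  : Rec 1
  projᴿ : ∀ {n} → Fin n → Rec n
  compᴿ : ∀ {m n} → Rec m → Vec (Rec n) m → Rec n
  precᴿ : ∀ {n} → Rec n → Rec (suc (suc n)) → Rec (suc n)
  minᴿ  : ∀ {n} → Rec (suc n) → Rec n

infix 4 _[_]⇓_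

-- The partial function denoted by f is defined at xs with value y.
data _[_]⇓_ : ∀ {n} → Rec n → Vec ℕ n → ℕ → Set where
  zero⇓ : ∀ {n} {xs : Vec ℕ n} → zeroᴿ [ xs ]⇓ 0
  suc⇓  : ∀ {x} → sucᴿ [ x ∷ [] ]⇓ suc x
  proj⇓ : ∀ {n} {i : Fin n} {xs : Vec ℕ n} → projᴿ i [ xs ]⇓ lookup xs i
  comp⇓ : ∀ {m n} {f : Rec m} {gs : Vec (Rec n) m} {xs ys y} →
          Pointwise (λ g z → g [ xs ]⇓ z) gs ys → f [ ys ]⇓ y →
          compᴿ f gs [ xs ]⇓ y
  prec-zero⇓ : ∀ {n} {f : Rec n} {g xs y} →
               f [ xs ]⇓ y → precᴿ f g [ 0 ∷ xs ]⇓ y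
  prec-suc⇓  : ∀ {n} {f : Rec n} {g xs k y z} →
               precᴿ f g [ k ∷ xs ]⇓ y → g [ k ∷ y ∷ xs ]⇓ z →
               precᴿ f g [ suc k ∷ xs ]⇓ z
  min⇓ : ∀ {n} {f : Rec (suc n)} {xs k} →
         f [ k ∷ xs ]⇓ 0 →
         (∀ i → i < k → ∃[ y ] f [ i ∷ xs ]⇓ suc y) →
         minᴿ f [ xs ]⇓ k

RecursiveSet : Pred ℕ 0ℓ → Set
RecursiveSet S = Σ (Rec 1) λ χ → ∀ m →
  (m ∈ S → χ [ m ∷ [] ]⇓ 1) × (¬ (m ∈ S) → χ [ m ∷ [] ]⇓ 0)

triangle : ℕ → ℕ
triangle zero    = zero
triangle (suc n) = suc n + triangle n

-- Cantor's bijection ℕ × ℕ → ℕ.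
pair : ℕ → ℕ → ℕ
pair a b = triangle (a + b) + b

code : ∀ {n} → LZF n → ℕ
code (i ≈̇ j)  = pair 0 (pair (toℕ i) (toℕ j))
code (i ∈̇ j)  = pair 1 (pair (toℕ i) (toℕ j))
code (i ∈ᶜ ())
code (¬̇ φ)    = pair 2 (code φ)
code (φ ∨̇ ψ)  = pair 3 (pair (code φ) (code ψ))
code (∃̇ φ)    = pair 4 (code φ)

RecursiveFormulas : ∀ {n} → Pred (LZF n) 0ℓ → Set
RecursiveFormulas p = RecursiveSet (λ m → ∃[ φ ] (φ ∈ p × code φ ≡ m))

------------------------------------------------------------------------
-- Structures for the language of set theory

record SetStructure ℓ : Set (lsuc ℓ) where
  infix 4 _ε_
  field
    Carrier : Set ℓ
    _ε_     : Rel Carrier ℓ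

module _ {ℓ} (𝓜 : SetStructure ℓ) where
  open SetStructure 𝓜 renaming (Carrier to M)

  Sat : ∀ {c n} → Fml c n → Vec (Pred M ℓ) c → Vec M n → Set ℓ
  Sat (i ≈̇ j)  Y v = lookup v i ≡ lookup v j
  Sat (i ∈̇ j)  Y v = lookup v i ε lookup v j
  Sat (i ∈ᶜ j) Y v = lookup v i ∈ lookup Y j
  Sat (¬̇ φ)    Y v = ¬ Sat φ Y v
  Sat (φ ∨̇ ψ)  Y v = Sat φ Y v ⊎ Sat ψ Y v
  Sat (∃̇ φ)    Y v = ∃[ x ] Sat φ Y (x ∷ v)

  Definable : Pred (Pred M ℓ) ℓ
  Definable X = Σ ℕ λ n → Σ (LZF (suc n)) λ φ → Σ (Vec M n) λ v →
    X ≐ (λ x → Sat φ [] (x ∷ v))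

  RecursivelySaturated : Set (lsuc 0ℓ ⊔ ℓ)
  RecursivelySaturated =
    ∀ {n} (p : Pred (LZF (suc n)) 0ℓ) → RecursiveFormulas p → (a : Vec M n) →
    (∀ (φs : List (LZF (suc n))) → All (_∈ p) φs →
       ∃[ x ] All (λ φ → Sat φ [] (x ∷ a)) φs) →
    ∃[ x ] (∀ φ → φ ∈ p → Sat φ [] (x ∷ a))

  ----------------------------------------------------------------------
  -- Set-theoretic notions in the sense of 𝓜: apart from the index of
  -- Numeral and Tagged, every quantifier below ranges over M, so that
  -- "finite ordinal", "formula", "depth", … include nonstandard ones.

  Empty : M → Set ℓ
  Empty e = ∀ x → ¬ (x ε e)

  -- c = {a, b}
  UPair : M → M → M → Set ℓ
  UPair c a b = ∀ x → (x ε c) ⇔ (x ≡ a ⊎ x ≡ b)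

  -- p = ⟨a, b⟩ = {{a}, {a, b}}
  OPair : M → M → M → Set ℓ
  OPair p a b = ∀ z → (z ε p) ⇔ (UPair z a a ⊎ UPair z a b)

  -- c = b ∪ {a}
  Adjoin : M → M → M → Set ℓ
  Adjoin c b a = ∀ x → (x ε c) ⇔ (x ε b ⊎ x ≡ a)

  -- m = l ∪ {l}
  Succ : M → M → Set ℓ
  Succ m l = Adjoin m l l

  _⊑_ : M → M → Set ℓ
  a ⊑ b = ∀ x → x ε a → x ε b

  Transitive : M → Set ℓ
  Transitive a = ∀ x → x ε a → x ⊑ a

  -- With foundation these are exactly the von Neumann ordinals.
  Ordinal : M → Set ℓ
  Ordinal a = Transitive a ×
    (∀ x y → x ε a → y ε a → x ε y ⊎ x ≡ y ⊎ y ε x)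

  -- The order of the ordinals.
  _≼_ : M → M → Set ℓ
  a ≼ b = a ε b ⊎ a ≡ b

  -- n ∈ ω^𝓜
  FiniteOrdinal : Pred M ℓ
  FiniteOrdinal n = Ordinal n ×
    (∀ m → m ≼ n → Empty m ⊎ ∃[ l ] Succ m l)

  -- a is the von Neumann numeral of the metatheoretic number n.
  Numeral : ℕ → M → Set ℓ
  Numeral zero    a = Empty a
  Numeral (suc n) a = ∃[ b ] (Numeral n b × Succ a b)

  -- The standard cut of 𝓜.
  Standard : Pred M ℓ
  Standard a = ∃[ n ] Numeral n a

  ωNonstandard : Set ℓ
  ωNonstandard = ∃[ a ] (FiniteOrdinal a × ¬ Standard a)

  -- ⟨a, b⟩ ∈ g
  Pair∈ : M → M → M → Set ℓ
  Pair∈ g a b = ∃[ p ] (OPair p a b × p ε g)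

  -- ⟨a, ⟨b, c⟩⟩ ∈ g
  Triple∈ : M → M → M → M → Set ℓ
  Triple∈ g a b c = ∃[ q ] (OPair q b c × Pair∈ g a q)

  ----------------------------------------------------------------------
  -- Formulas as elements of 𝓜

  -- p = ⟨n, x⟩, where n is a standard numeral serving as a tag
  Tagged : ℕ → M → M → Set ℓ
  Tagged n p x = ∃[ t ] (Numeral n t × OPair p t x)

  -- p = ⟨n, ⟨x, y⟩⟩
  Tagged₂ : ℕ → M → M → M → Set ℓ
  Tagged₂ n p x y = ∃[ q ] (OPair q x y × Tagged n p q)

  -- t is the variable vᵢ; i may be nonstandard
  IsVar : M → M → Set ℓ
  IsVar t i = FiniteOrdinal i × Tagged 0 t i

  -- t is the constant c_a
  IsConst : M → M → Set ℓ
  IsConst = Tagged 1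

  -- φ is ⌜t = u⌝, ⌜t ∈ u⌝, ⌜ψ ∨ χ⌝, ⌜∃vᵢ ψ⌝ respectively
  IsEq IsMem IsOr IsEx : M → M → M → Set ℓ
  IsEq  = Tagged₂ 2
  IsMem = Tagged₂ 3
  IsOr  = Tagged₂ 5
  IsEx φ i ψ = FiniteOrdinal i × Tagged₂ 6 φ i ψ

  -- φ is ⌜¬ψ⌝
  IsNeg : M → M → Set ℓ
  IsNeg = Tagged 4

  IsAtomic : M → Set ℓ
  IsAtomic φ = ∃[ t ] ∃[ u ]
    ((∃[ i ] IsVar t i) × (∃[ j ] IsVar u j) × (IsEq φ t u ⊎ IsMem φ t u))

  -- m = max(d, e) for ordinals d, e
  IsMax : M → M → M → Set ℓ
  IsMax m d e = (d ≼ e × m ≡ e) ⊎ (e ≼ d × m ≡ d)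

  -- Every pair ⟨φ, d⟩ in g is justified by the recursion for the length d
  -- of the longest path in the parsing tree of φ, using only pairs in g.
  -- Foundation in 𝓜 makes this recursion well-founded.
  DepthCertificate : M → Set ℓ
  DepthCertificate g = ∀ φ d → Pair∈ g φ d →
      (IsAtomic φ × Empty d)
    ⊎ (∃[ ψ ] ∃[ e ] (IsNeg φ ψ × Pair∈ g ψ e × Succ d e))
    ⊎ (∃[ ψ ] ∃[ χ ] ∃[ e ] ∃[ e′ ] ∃[ m ]
         (IsOr φ ψ χ × Pair∈ g ψ e × Pair∈ g χ e′ × IsMax m e e′ × Succ d m))
    ⊎ (∃[ i ] ∃[ ψ ] ∃[ e ] (IsEx φ i ψ × Pair∈ g ψ e × Succ d e))

  -- φ is an 𝓛_ZF-formula (without constants) of depth d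
  HasDepth : M → M → Set ℓ
  HasDepth φ d = ∃[ g ] (DepthCertificate g × Pair∈ g φ d)

  -- φ ∈ Depth_k
  Depth≤ : M → M → Set ℓ
  Depth≤ k φ = ∃[ d ] (HasDepth φ d × d ≼ k)

  -- α is single-valued, hence a partial assignment i ↦ α(i) of elements to
  -- variable indices.
  IsFunction : M → Set ℓ
  IsFunction α = ∀ i a b → Pair∈ α i a → Pair∈ α i b → a ≡ b

  -- u results from the term t by replacing vᵢ with c_{α(i)}, unless i ∈ b
  TermSubst : M → M → M → M → Set ℓ
  TermSubst α b t u =
      (∃[ i ] (IsVar t i × i ε b × u ≡ t))
    ⊎ (∃[ i ] ∃[ a ] (IsVar t i × ¬ (i ε b) × Pair∈ α i a × IsConst u a))
    ⊎ (∃[ a ] (IsConst t a × u ≡ t))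

  -- Every ⟨φ, ⟨b, s⟩⟩ in g is justified, using only triples in g, by the
  -- recursion saying that s results from φ by replacing the free
  -- occurrences of each vᵢ, i ∉ b, with c_{α(i)}; b collects the indices
  -- of the quantifiers already passed.
  SubstCertificate : M → M → Set ℓ
  SubstCertificate α g = ∀ φ b s → Triple∈ g φ b s →
      (∃[ t ] ∃[ t′ ] ∃[ u ] ∃[ u′ ]
         (TermSubst α b t u × TermSubst α b t′ u′ ×
          ((IsEq φ t t′ × IsEq s u u′) ⊎ (IsMem φ t t′ × IsMem s u u′))))
    ⊎ (∃[ ψ ] ∃[ r ] (IsNeg φ ψ × IsNeg s r × Triple∈ g ψ b r))
    ⊎ (∃[ ψ ] ∃[ χ ] ∃[ r ] ∃[ q ]
         (IsOr φ ψ χ × IsOr s r q × Triple∈ g ψ b r × Triple∈ g χ b q))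
    ⊎ (∃[ i ] ∃[ ψ ] ∃[ r ] ∃[ b′ ]
         (IsEx φ i ψ × IsEx s i r × Adjoin b′ b i × Triple∈ g ψ b′ r))

  -- s is the sentence obtained from the formula φ (possibly containing
  -- constants) by substituting c_{α(i)} for every free vᵢ.  As α must be
  -- defined at every free variable of φ, s has no free variables.
  Subst : M → M → M → Set ℓ
  Subst φ α s = ∃[ g ] ∃[ e ] (Empty e × SubstCertificate α g × Triple∈ g φ e s)

  -- s is a sentence obtained by substituting constants into a formula in
  -- Depth_k
  Sentence≤ : M → M → Set ℓ
  Sentence≤ k s = ∃[ φ ] ∃[ α ] (Depth≤ k φ × IsFunction α × Subst φ α s)

  -- s = ψ(c_x), the substitution being for vᵢ: here α = {⟨i, x⟩}
  Instance : M → M → M → M → Set ℓ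
  Instance ψ i x s = ∃[ p ] ∃[ α ] (OPair p i x × UPair α p p × Subst ψ α s)

  record IsDepthTruthClass (k : M) (T : Pred M ℓ) : Set ℓ where
    field
      sentences : T ⊆ Sentence≤ k
      eq-clause : ∀ {s t u a b} → Sentence≤ k s →
        IsConst t a → IsConst u b → IsEq s t u → (s ∈ T) ⇔ (a ≡ b)
      mem-clause : ∀ {s t u a b} → Sentence≤ k s →
        IsConst t a → IsConst u b → IsMem s t u → (s ∈ T) ⇔ (a ε b)
      neg-clause : ∀ {s ψ} → Sentence≤ k s → IsNeg s ψ →
        (s ∈ T) ⇔ (¬ (ψ ∈ T))
      or-clause : ∀ {s ψ χ} → Sentence≤ k s → IsOr s ψ χ →
        (s ∈ T) ⇔ (ψ ∈ T ⊎ χ ∈ T)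
      ex-clause : ∀ {s i ψ} → Sentence≤ k s → IsEx s i ψ →
        (s ∈ T) ⇔ (∃[ x ] ∃[ r ] (Instance ψ i x r × r ∈ T))

  ----------------------------------------------------------------------
  -- Gödel–Bernays class theory

  Infinity : Set ℓ
  Infinity = ∃[ w ] ((∃[ e ] (Empty e × e ε w)) ×
                     (∀ y → y ε w → ∃[ z ] (Succ z y × z ε w)))

  TransitiveClosures : Set ℓ
  TransitiveClosures = ∀ a → ∃[ t ]
    (a ⊑ t × Transitive t × (∀ s → a ⊑ s → Transitive s → t ⊑ s))

  module _ {ℓ′} (𝔛 : Pred (Pred M ℓ) ℓ′) where

    C-Most : Pred M (lsuc ℓ ⊔ ℓ′)
    C-Most k = FiniteOrdinal k × ∃[ T ] (T ∈ 𝔛 × IsDepthTruthClass k T)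

    -- The axioms of GB other than infinity.  There is no axiom of choice.
    record IsGB₀ : Set (lsuc ℓ ⊔ ℓ′) where
      field
        -- 𝔛 is a collection of subsets of M: membership in 𝔛 depends only
        -- on the elements of a class.
        respects-≐ : ∀ {X Y} → X ≐ Y → X ∈ 𝔛 → Y ∈ 𝔛
        inhabited : M
        extensionality : ∀ a b → (∀ x → (x ε a) ⇔ (x ε b)) → a ≡ b
        pairing : ∀ a b → ∃[ c ] UPair c a b
        union : ∀ a → ∃[ u ] (∀ x → (x ε u) ⇔ (∃[ y ] (y ε a × x ε y)))
        powerset : ∀ a → ∃[ p ] (∀ x → (x ε p) ⇔ (x ⊑ a))
        foundation : ∀ a → (∃[ x ] (x ε a)) →
          ∃[ x ] (x ε a × (∀ y → y ε x → ¬ (y ε a)))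
        comprehension : ∀ {c n} (φ : Fml c (suc n)) (Y : Vec (Pred M ℓ) c) →
          AllVec (_∈ 𝔛) Y → (v : Vec M n) → (λ x → Sat φ Y (x ∷ v)) ∈ 𝔛
        -- The image of a set under a class function is a set.
        replacement : ∀ F → F ∈ 𝔛 →
          (∀ {p q x y z} → OPair p x y → OPair q x z → p ∈ F → q ∈ F → y ≡ z) →
          ∀ a → ∃[ b ] (∀ y → (y ε b) ⇔
                              (∃[ x ] ∃[ p ] (x ε a × OPair p x y × p ∈ F)))

    IsGB⁺∞ IsGB⁻∞ : Set (lsuc ℓ ⊔ ℓ′)
    IsGB⁺∞ = IsGB₀ × Infinity
    IsGB⁻∞ = IsGB₀ × ¬ Infinity × TransitiveClosures

{-# OPTIONS --safe #-}

-- For standard k, a Depth_k-truth class is obtained from k + 1 applications of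
-- comprehension, each defining truth in terms of truth for immediate subsentences.
-- Conversely, let T be a Depth_k-truth class with k nonstandard.  Every standard
-- formula has depth below k, so T agrees with satisfaction on all standard formulas.
-- (a) If every class is definable, then so is the class of those x that code a
-- formula together with parameters and do not satisfy it according to T; applying
-- its definition to a code of that definition gives a contradiction, as in Tarski's
-- theorem.
-- (b) A recursive set of codes of formulas is represented by a formula in 𝓜.  Given
-- a finitely satisfiable recursive type, for each standard N some x satisfies,
-- according to T, all its formulas with code below N.  This is a property of N
-- expressible with T, so it holds for some nonstandard N as well, and a
-- corresponding x realises the type.
module Submission where

open import Defs
open import Level using (_⊔_; 0ℓ; Lift; lift; lower) renaming (suc to lsuc)
open import Axiom.DoubleNegationElimination using (em⇒dne)
open import Axiom.ExcludedMiddle using (ExcludedMiddle)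
open import Data.Empty using (⊥; ⊥-elim)
open import Data.Fin using (Fin; zero; suc; toℕ; _↑ʳ_)
open import Data.List using (List; []; _∷_)
open import Data.List.Membership.Propositional using () renaming (_∈_ to _∈ˡ_)
open import Data.List.Relation.Unary.All as All using (All; []; _∷_)
open import Data.List.Relation.Unary.Any using (here; there)
open import Data.Nat using (ℕ; zero; suc; _+_; _<_; _≤_; z≤n; s≤s; s≤s⁻¹)
  renaming (_⊔_ to _⊔ℕ_)
open import Data.Nat.Properties
open import Data.Product using (∃-syntax; _×_; _,_; proj₁; proj₂)
open import Data.Sum using (_⊎_; inj₁; inj₂; [_,_]′)
open import Data.Unit.Polymorphic using (⊤)
open import Data.Vec as Vec using (Vec; []; _∷_; lookup)
open import Data.Vec.Properties using (lookup-map)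
open import Data.Vec.Relation.Binary.Pointwise.Inductive using (Pointwise; []; _∷_)
open import Data.Vec.Relation.Unary.All using ([]; _∷_) renaming (All to AllVec)
open import Function.Base using (_∘_; id)
open import Function.Bundles using (_⇔_; mk⇔; module Equivalence)
open import Function.Construct.Composition using (_⇔-∘_)
open import Function.Construct.Symmetry using (⇔-sym)
open import Relation.Binary.Definitions using (tri<; tri≈; tri>)
open import Relation.Binary.PropositionalEquality
  using (_≡_; refl; sym; trans; cong; cong₂; subst)
open import Relation.Nullary using (¬_; Dec; yes; no; contradiction)
open import Relation.Nullary.Decidable using (map′)
open import Relation.Unary using (Pred; _∈_; _⊆_; _≐_)

open Equivalence using (to; from)

-- Two obstacles shape the proof. A formula of standard depth in `𝓜` need not be standard, since its
-- variable indices may be nonstandard; truth classes for standard `k` are therefore built by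
-- recursion on depth, and an instance of an existential sentence must be recognised as a single
-- substitution into a formula of smaller depth. Moreover, the sets witnessing substitution,
-- decoding or a computation are arbitrary elements of `𝓜` and may contain nonstandard material;
-- uniqueness is proved by external induction on a standard formula or evaluation, which follows
-- only the entries that it reaches.
--
-- Overspill applies only to classes in `𝔛`, so the internal notions come with formulas expressing
-- them. Induction runs over the ordinals up to a fixed finite `k` and rests on foundation, whether
-- the finite ordinals form a set or a proper class.
--
-- The numerical `code` uses de Bruijn indices, while `encode` names variables by levels, so that
-- terms need no shifting under a quantifier; decoding inside `𝓜` translates by the equation index +
-- level + 1 = context length.

lower-em : ∀ a {b} → ExcludedMiddle (a ⊔ b) → ExcludedMiddle b
lower-em a {b} em {P} = map′ lower lift (em {Lift (a ⊔ b) P})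

pattern x0 = zero
pattern x1 = suc x0
pattern x2 = suc x1
pattern x3 = suc x2
pattern x4 = suc x3
pattern x5 = suc x4
pattern x6 = suc x5
pattern x7 = suc x6

-- Predicates on the model that are given by formulas

module Expressibility {ℓ} (em : ExcludedMiddle ℓ) (𝓜 : SetStructure ℓ) where
  open SetStructure 𝓜 renaming (Carrier to M)

  -- Unlike Vec, this nested product has η, so that variable lookup computes
  -- under a binder.
  Env : ℕ → Set ℓ
  Env zero    = ⊤
  Env (suc n) = M × Env n

  infixl 9 _!_
  _!_ : ∀ {n} → Env n → Fin n → M
  e ! zero  = proj₁ e
  e ! suc i = proj₂ e ! i

  toVec : ∀ {n} → Env n → Vec M n
  toVec {zero}  _       = []
  toVec {suc n} (x , e) = x ∷ toVec e

  lookup-toVec : ∀ {n} (e : Env n) i → lookup (toVec e) i ≡ e ! i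
  lookup-toVec e zero    = refl
  lookup-toVec e (suc i) = lookup-toVec (proj₂ e) i

  -- The index is the semantic predicate, not the formula. The combinators below thus mirror the
  -- definitions of the set-theoretic notions clause by clause, and the formula is assembled along
  -- the way.
  record Expressible {c n} (Y : Vec (Pred M ℓ) c) (P : Env n → Set ℓ) : Set ℓ where
    field
      fml     : Fml c n
      correct : ∀ e → Sat 𝓜 fml Y (toVec e) ⇔ P e
  open Expressible public

  module _ {c} {Y : Vec (Pred M ℓ) c} where

    private
      𝓔 : ∀ {n} → (Env n → Set ℓ) → Set ℓ
      𝓔 = Expressible Y

    ≡ᵉ : ∀ {n} (i j : Fin n) → 𝓔 (λ e → e ! i ≡ e ! j)
    ≡ᵉ i j .fml = i ≈̇ j
    ≡ᵉ i j .correct e rewrite lookup-toVec e i | lookup-toVec e j = mk⇔ id id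

    εᵉ : ∀ {n} (i j : Fin n) → 𝓔 (λ e → e ! i ε e ! j)
    εᵉ i j .fml = i ∈̇ j
    εᵉ i j .correct e rewrite lookup-toVec e i | lookup-toVec e j = mk⇔ id id

    classᵉ : ∀ {n} (j : Fin c) (i : Fin n) → 𝓔 (λ e → lookup Y j (e ! i))
    classᵉ j i .fml = i ∈ᶜ j
    classᵉ j i .correct e rewrite lookup-toVec e i = mk⇔ id id

    ¬ᵉ : ∀ {n} {P : Env n → Set ℓ} → 𝓔 P → 𝓔 (λ e → ¬ P e)
    ¬ᵉ p .fml = ¬̇ fml p
    ¬ᵉ p .correct e = mk⇔ (_∘ from (correct p e)) (_∘ to (correct p e))

    infixr 4 _∨ᵉ_
    _∨ᵉ_ : ∀ {n} {P Q : Env n → Set ℓ} → 𝓔 P → 𝓔 Q → 𝓔 (λ e → P e ⊎ Q e)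
    (p ∨ᵉ q) .fml = fml p ∨̇ fml q
    (p ∨ᵉ q) .correct e = mk⇔
      (λ { (inj₁ x) → inj₁ (to (correct p e) x) ; (inj₂ y) → inj₂ (to (correct q e) y) })
      (λ { (inj₁ x) → inj₁ (from (correct p e) x) ; (inj₂ y) → inj₂ (from (correct q e) y) })

    ∃ᵉ : ∀ {n} {P : M → Env n → Set ℓ} →
         𝓔 (λ e → P (proj₁ e) (proj₂ e)) → 𝓔 (λ e → ∃[ x ] P x e)
    ∃ᵉ p .fml = ∃̇ fml p
    ∃ᵉ p .correct e = mk⇔
      (λ (x , s) → x , to (correct p (x , e)) s)
      (λ (x , s) → x , from (correct p (x , e)) s)

    respᵉ : ∀ {n} {P Q : Env n → Set ℓ} → (∀ e → P e ⇔ Q e) → 𝓔 P → 𝓔 Q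
    respᵉ f p .fml = fml p
    respᵉ f p .correct e = mk⇔ (to (f e) ∘ to (correct p e)) (from (correct p e) ∘ from (f e))

    infixr 5 _∧ᵉ_
    -- The language has only negation, disjunction and the existential quantifier, so conjunction is
    -- a De Morgan dual, and excluded middle recovers its two halves. Implication and `∀ᵉ` are
    -- treated in the same way.
    _∧ᵉ_ : ∀ {n} {P Q : Env n → Set ℓ} → 𝓔 P → 𝓔 Q → 𝓔 (λ e → P e × Q e)
    p ∧ᵉ q = respᵉ
      (λ e → mk⇔ (λ h → em⇒dne em (h ∘ inj₁) , em⇒dne em (h ∘ inj₂))
                 (λ { (x , y) (inj₁ ¬x) → ¬x x ; (x , y) (inj₂ ¬y) → ¬y y }))
      (¬ᵉ (¬ᵉ p ∨ᵉ ¬ᵉ q))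

    infixr 3 _⇒ᵉ_
    _⇒ᵉ_ : ∀ {n} {P Q : Env n → Set ℓ} → 𝓔 P → 𝓔 Q → 𝓔 (λ e → P e → Q e)
    _⇒ᵉ_ {P = P} p q = respᵉ
      (λ e → mk⇔ (λ { (inj₁ ¬x) x → contradiction x ¬x ; (inj₂ y) _ → y }) (λ f → case e f em))
      (¬ᵉ p ∨ᵉ q)
      where
        case : ∀ e {B : Set ℓ} → (P e → B) → Dec (P e) → ¬ P e ⊎ B
        case e f (yes x) = inj₂ (f x)
        case e f (no ¬x) = inj₁ ¬x

    infix 3 _⇔ᵉ_
    _⇔ᵉ_ : ∀ {n} {P Q : Env n → Set ℓ} → 𝓔 P → 𝓔 Q → 𝓔 (λ e → P e ⇔ Q e)
    p ⇔ᵉ q = respᵉ (λ e → mk⇔ (λ (f , g) → mk⇔ f g) (λ h → to h , from h))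
                   ((p ⇒ᵉ q) ∧ᵉ (q ⇒ᵉ p))

    ∀ᵉ : ∀ {n} {P : M → Env n → Set ℓ} →
         𝓔 (λ e → P (proj₁ e) (proj₂ e)) → 𝓔 (λ e → ∀ x → P x e)
    ∀ᵉ p = respᵉ
      (λ e → mk⇔ (λ h x → em⇒dne em (λ ¬x → h (x , ¬x))) (λ h (x , ¬x) → ¬x (h x)))
      (¬ᵉ (∃ᵉ (¬ᵉ p)))

    Emptyᵉ : ∀ {n} (a : Fin n) → 𝓔 (λ e → Empty 𝓜 (e ! a))
    Emptyᵉ a = ∀ᵉ (¬ᵉ (εᵉ x0 (1 ↑ʳ a)))

    UPairᵉ : ∀ {n} (c a b : Fin n) → 𝓔 (λ e → UPair 𝓜 (e ! c) (e ! a) (e ! b))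
    UPairᵉ c a b = ∀ᵉ (εᵉ x0 (1 ↑ʳ c) ⇔ᵉ (≡ᵉ x0 (1 ↑ʳ a) ∨ᵉ ≡ᵉ x0 (1 ↑ʳ b)))

    OPairᵉ : ∀ {n} (p a b : Fin n) → 𝓔 (λ e → OPair 𝓜 (e ! p) (e ! a) (e ! b))
    OPairᵉ p a b = ∀ᵉ (εᵉ x0 (1 ↑ʳ p) ⇔ᵉ
      (UPairᵉ x0 (1 ↑ʳ a) (1 ↑ʳ a) ∨ᵉ UPairᵉ x0 (1 ↑ʳ a) (1 ↑ʳ b)))

    Adjoinᵉ : ∀ {n} (c b a : Fin n) → 𝓔 (λ e → Adjoin 𝓜 (e ! c) (e ! b) (e ! a))
    Adjoinᵉ c b a = ∀ᵉ (εᵉ x0 (1 ↑ʳ c) ⇔ᵉ (εᵉ x0 (1 ↑ʳ b) ∨ᵉ ≡ᵉ x0 (1 ↑ʳ a)))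

    Succᵉ : ∀ {n} (m l : Fin n) → 𝓔 (λ e → Succ 𝓜 (e ! m) (e ! l))
    Succᵉ m l = Adjoinᵉ m l l

    ≼ᵉ : ∀ {n} (a b : Fin n) → 𝓔 (λ e → _≼_ 𝓜 (e ! a) (e ! b))
    ≼ᵉ a b = εᵉ a b ∨ᵉ ≡ᵉ a b

    ⊑ᵉ : ∀ {n} (a b : Fin n) → 𝓔 (λ e → _⊑_ 𝓜 (e ! a) (e ! b))
    ⊑ᵉ a b = ∀ᵉ (εᵉ x0 (1 ↑ʳ a) ⇒ᵉ εᵉ x0 (1 ↑ʳ b))

    FiniteOrdinalᵉ : ∀ {n} (a : Fin n) → 𝓔 (λ e → FiniteOrdinal 𝓜 (e ! a))
    FiniteOrdinalᵉ a =
      (∀ᵉ (εᵉ x0 (1 ↑ʳ a) ⇒ᵉ ⊑ᵉ x0 (1 ↑ʳ a)) ∧ᵉ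
       ∀ᵉ (∀ᵉ (εᵉ x1 (2 ↑ʳ a) ⇒ᵉ εᵉ x0 (2 ↑ʳ a) ⇒ᵉ εᵉ x1 x0 ∨ᵉ ≡ᵉ x1 x0 ∨ᵉ εᵉ x0 x1))) ∧ᵉ
      ∀ᵉ (≼ᵉ x0 (1 ↑ʳ a) ⇒ᵉ Emptyᵉ x0 ∨ᵉ ∃ᵉ (Succᵉ x1 x0))

    Numeralᵉ : ∀ {n} k (a : Fin n) → 𝓔 (λ e → Numeral 𝓜 k (e ! a))
    Numeralᵉ zero    a = Emptyᵉ a
    Numeralᵉ (suc k) a = ∃ᵉ (Numeralᵉ k x0 ∧ᵉ Succᵉ (1 ↑ʳ a) x0)

    Pair∈ᵉ : ∀ {n} (g a b : Fin n) → 𝓔 (λ e → Pair∈ 𝓜 (e ! g) (e ! a) (e ! b))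
    Pair∈ᵉ g a b = ∃ᵉ (OPairᵉ x0 (1 ↑ʳ a) (1 ↑ʳ b) ∧ᵉ εᵉ x0 (1 ↑ʳ g))

    Triple∈ᵉ : ∀ {n} (g a b c : Fin n) →
               𝓔 (λ e → Triple∈ 𝓜 (e ! g) (e ! a) (e ! b) (e ! c))
    Triple∈ᵉ g a b c = ∃ᵉ (OPairᵉ x0 (1 ↑ʳ b) (1 ↑ʳ c) ∧ᵉ Pair∈ᵉ (1 ↑ʳ g) (1 ↑ʳ a) x0)

    Taggedᵉ : ∀ {n} k (p a : Fin n) → 𝓔 (λ e → Tagged 𝓜 k (e ! p) (e ! a))
    Taggedᵉ k p a = ∃ᵉ (Numeralᵉ k x0 ∧ᵉ OPairᵉ (1 ↑ʳ p) x0 (1 ↑ʳ a))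

    Tagged₂ᵉ : ∀ {n} k (p a b : Fin n) →
               𝓔 (λ e → Tagged₂ 𝓜 k (e ! p) (e ! a) (e ! b))
    Tagged₂ᵉ k p a b = ∃ᵉ (OPairᵉ x0 (1 ↑ʳ a) (1 ↑ʳ b) ∧ᵉ Taggedᵉ k (1 ↑ʳ p) x0)

    IsVarᵉ : ∀ {n} (t i : Fin n) → 𝓔 (λ e → IsVar 𝓜 (e ! t) (e ! i))
    IsVarᵉ t i = FiniteOrdinalᵉ i ∧ᵉ Taggedᵉ 0 t i

    IsExᵉ : ∀ {n} (φ i ψ : Fin n) → 𝓔 (λ e → IsEx 𝓜 (e ! φ) (e ! i) (e ! ψ))
    IsExᵉ φ i ψ = FiniteOrdinalᵉ i ∧ᵉ Tagged₂ᵉ 6 φ i ψ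

    IsAtomicᵉ : ∀ {n} (φ : Fin n) → 𝓔 (λ e → IsAtomic 𝓜 (e ! φ))
    IsAtomicᵉ φ = ∃ᵉ (∃ᵉ (∃ᵉ (IsVarᵉ x2 x0) ∧ᵉ ∃ᵉ (IsVarᵉ x1 x0) ∧ᵉ
      (Tagged₂ᵉ 2 (2 ↑ʳ φ) x1 x0 ∨ᵉ Tagged₂ᵉ 3 (2 ↑ʳ φ) x1 x0)))

    IsMaxᵉ : ∀ {n} (m d d′ : Fin n) → 𝓔 (λ e → IsMax 𝓜 (e ! m) (e ! d) (e ! d′))
    IsMaxᵉ m d d′ = (≼ᵉ d d′ ∧ᵉ ≡ᵉ m d′) ∨ᵉ (≼ᵉ d′ d ∧ᵉ ≡ᵉ m d)

    DepthCertificateᵉ : ∀ {n} (g : Fin n) → 𝓔 (λ e → DepthCertificate 𝓜 (e ! g))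
    DepthCertificateᵉ g = ∀ᵉ (∀ᵉ (Pair∈ᵉ (2 ↑ʳ g) x1 x0 ⇒ᵉ
         (IsAtomicᵉ x1 ∧ᵉ Emptyᵉ x0)
      ∨ᵉ ∃ᵉ (∃ᵉ (Taggedᵉ 4 x3 x1 ∧ᵉ Pair∈ᵉ (4 ↑ʳ g) x1 x0 ∧ᵉ Succᵉ x2 x0))
      ∨ᵉ ∃ᵉ (∃ᵉ (∃ᵉ (∃ᵉ (∃ᵉ (Tagged₂ᵉ 5 x6 x4 x3 ∧ᵉ Pair∈ᵉ (7 ↑ʳ g) x4 x2 ∧ᵉ
           Pair∈ᵉ (7 ↑ʳ g) x3 x1 ∧ᵉ IsMaxᵉ x0 x2 x1 ∧ᵉ Succᵉ x5 x0)))))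
      ∨ᵉ ∃ᵉ (∃ᵉ (∃ᵉ (IsExᵉ x4 x2 x1 ∧ᵉ Pair∈ᵉ (5 ↑ʳ g) x1 x0 ∧ᵉ Succᵉ x3 x0)))))

    Depth≤ᵉ : ∀ {n} (k φ : Fin n) → 𝓔 (λ e → Depth≤ 𝓜 (e ! k) (e ! φ))
    Depth≤ᵉ k φ = ∃ᵉ (∃ᵉ (DepthCertificateᵉ x0 ∧ᵉ Pair∈ᵉ x0 (2 ↑ʳ φ) x1) ∧ᵉ ≼ᵉ x0 (1 ↑ʳ k))

    IsFunctionᵉ : ∀ {n} (α : Fin n) → 𝓔 (λ e → IsFunction 𝓜 (e ! α))
    IsFunctionᵉ α = ∀ᵉ (∀ᵉ (∀ᵉ
      (Pair∈ᵉ (3 ↑ʳ α) x2 x1 ⇒ᵉ Pair∈ᵉ (3 ↑ʳ α) x2 x0 ⇒ᵉ ≡ᵉ x1 x0)))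

    TermSubstᵉ : ∀ {n} (α b t u : Fin n) →
                 𝓔 (λ e → TermSubst 𝓜 (e ! α) (e ! b) (e ! t) (e ! u))
    TermSubstᵉ α b t u =
         ∃ᵉ (IsVarᵉ (1 ↑ʳ t) x0 ∧ᵉ εᵉ x0 (1 ↑ʳ b) ∧ᵉ ≡ᵉ (1 ↑ʳ u) (1 ↑ʳ t))
      ∨ᵉ ∃ᵉ (∃ᵉ (IsVarᵉ (2 ↑ʳ t) x1 ∧ᵉ ¬ᵉ (εᵉ x1 (2 ↑ʳ b)) ∧ᵉ Pair∈ᵉ (2 ↑ʳ α) x1 x0 ∧ᵉ
           Taggedᵉ 1 (2 ↑ʳ u) x0))
      ∨ᵉ ∃ᵉ (Taggedᵉ 1 (1 ↑ʳ t) x0 ∧ᵉ ≡ᵉ (1 ↑ʳ u) (1 ↑ʳ t))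

    SubstCertificateᵉ : ∀ {n} (α g : Fin n) →
                        𝓔 (λ e → SubstCertificate 𝓜 (e ! α) (e ! g))
    SubstCertificateᵉ α g = ∀ᵉ (∀ᵉ (∀ᵉ (Triple∈ᵉ (3 ↑ʳ g) x2 x1 x0 ⇒ᵉ
         ∃ᵉ (∃ᵉ (∃ᵉ (∃ᵉ (TermSubstᵉ (7 ↑ʳ α) x5 x3 x1 ∧ᵉ TermSubstᵉ (7 ↑ʳ α) x5 x2 x0 ∧ᵉ
           ((Tagged₂ᵉ 2 x6 x3 x2 ∧ᵉ Tagged₂ᵉ 2 x4 x1 x0) ∨ᵉ
            (Tagged₂ᵉ 3 x6 x3 x2 ∧ᵉ Tagged₂ᵉ 3 x4 x1 x0))))))
      ∨ᵉ ∃ᵉ (∃ᵉ (Taggedᵉ 4 x4 x1 ∧ᵉ Taggedᵉ 4 x2 x0 ∧ᵉ Triple∈ᵉ (5 ↑ʳ g) x1 x3 x0))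
      ∨ᵉ ∃ᵉ (∃ᵉ (∃ᵉ (∃ᵉ (Tagged₂ᵉ 5 x6 x3 x2 ∧ᵉ Tagged₂ᵉ 5 x4 x1 x0 ∧ᵉ
           Triple∈ᵉ (7 ↑ʳ g) x3 x5 x1 ∧ᵉ Triple∈ᵉ (7 ↑ʳ g) x2 x5 x0))))
      ∨ᵉ ∃ᵉ (∃ᵉ (∃ᵉ (∃ᵉ (IsExᵉ x6 x3 x2 ∧ᵉ IsExᵉ x4 x3 x1 ∧ᵉ Adjoinᵉ x0 x5 x3 ∧ᵉ
           Triple∈ᵉ (7 ↑ʳ g) x2 x0 x1)))))))

    Substᵉ : ∀ {n} (φ α s : Fin n) → 𝓔 (λ e → Subst 𝓜 (e ! φ) (e ! α) (e ! s))
    Substᵉ φ α s = ∃ᵉ (∃ᵉ (Emptyᵉ x0 ∧ᵉ SubstCertificateᵉ (2 ↑ʳ α) x1 ∧ᵉ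
      Triple∈ᵉ x1 (2 ↑ʳ φ) x0 (2 ↑ʳ s)))

    Sentence≤ᵉ : ∀ {n} (k s : Fin n) → 𝓔 (λ e → Sentence≤ 𝓜 (e ! k) (e ! s))
    Sentence≤ᵉ k s = ∃ᵉ (∃ᵉ (Depth≤ᵉ (2 ↑ʳ k) x1 ∧ᵉ IsFunctionᵉ x0 ∧ᵉ Substᵉ x1 x0 (2 ↑ʳ s)))

    Instanceᵉ : ∀ {n} (ψ i x s : Fin n) →
                𝓔 (λ e → Instance 𝓜 (e ! ψ) (e ! i) (e ! x) (e ! s))
    Instanceᵉ ψ i x s = ∃ᵉ (∃ᵉ (OPairᵉ x1 (2 ↑ʳ i) (2 ↑ʳ x) ∧ᵉ UPairᵉ x0 x1 x1 ∧ᵉ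
      Substᵉ (2 ↑ʳ ψ) x0 (2 ↑ʳ s)))

-- Basic set theory, numerals, induction and overspill

module Sets {ℓ ℓ′} (em : ExcludedMiddle ℓ) (𝓜 : SetStructure ℓ)
  (𝔛 : Pred (Pred (SetStructure.Carrier 𝓜) ℓ) ℓ′) (gb : IsGB₀ 𝓜 𝔛) where

  open SetStructure 𝓜 renaming (Carrier to M)
  open Expressibility em 𝓜
  open IsGB₀ gb

  expressible∈𝔛 : ∀ {c} n {Y : Vec (Pred M ℓ) c} {P : Env (suc n) → Set ℓ} →
    Expressible Y P → AllVec (_∈ 𝔛) Y → ∀ e → (λ x → P (x , e)) ∈ 𝔛
  expressible∈𝔛 n {Y} p Y∈𝔛 e = respects-≐
    ((λ {x} → to (correct p (x , e))) , (λ {x} → from (correct p (x , e))))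
    (comprehension (fml p) Y Y∈𝔛 (toVec e))

  ext : ∀ {a} {P : Pred M a} {b c} → (∀ x → (x ε b) ⇔ P x) → (∀ x → (x ε c) ⇔ P x) → b ≡ c
  ext f g = extensionality _ _ λ x → mk⇔ (from (g x) ∘ to (f x)) (from (f x) ∘ to (g x))

  abstract
    upair : M → M → M
    upair a b = proj₁ (pairing a b)

    upair-UPair : ∀ a b → UPair 𝓜 (upair a b) a b
    upair-UPair a b = proj₂ (pairing a b)

  UPair⇒≡ : ∀ {c a b} → UPair 𝓜 c a b → c ≡ upair a b
  UPair⇒≡ h = ext h (upair-UPair _ _)

  abstract
    opair : M → M → M
    opair a b = upair (upair a a) (upair a b)

    opair-OPair : ∀ a b → OPair 𝓜 (opair a b) a b
    opair-OPair a b z = mk⇔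
      (λ h → [ (λ { refl → inj₁ (upair-UPair a a) }) , (λ { refl → inj₂ (upair-UPair a b) }) ]′
               (to (upair-UPair (upair a a) (upair a b) z) h))
      (λ h → from (upair-UPair _ _ z) ([ inj₁ ∘ UPair⇒≡ , inj₂ ∘ UPair⇒≡ ]′ h))

  OPair⇒≡ : ∀ {p a b} → OPair 𝓜 p a b → p ≡ opair a b
  OPair⇒≡ h = ext h (opair-OPair _ _)

  upair-∋ˡ : ∀ {a b} → a ε upair a b
  upair-∋ˡ = from (upair-UPair _ _ _) (inj₁ refl)

  upair-∋ʳ : ∀ {a b} → b ε upair a b
  upair-∋ʳ = from (upair-UPair _ _ _) (inj₂ refl)

  upair-∈ : ∀ {x a b} → x ε upair a b → x ≡ a ⊎ x ≡ b
  upair-∈ = to (upair-UPair _ _ _)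

  upair-injʳ : ∀ {a b c} → upair a b ≡ upair a c → b ≡ c
  upair-injʳ {a} {b} {c} eq with upair-∈ (subst (b ε_) eq upair-∋ʳ)
  ... | inj₂ b≡c = b≡c
  ... | inj₁ refl with upair-∈ (subst (c ε_) (sym eq) upair-∋ʳ)
  ... | inj₁ c≡a = sym c≡a
  ... | inj₂ c≡a = sym c≡a

  upair-diagonal : ∀ {a b c} → upair a a ≡ upair b c → a ≡ b
  upair-diagonal {b = b} eq with upair-∈ (subst (b ε_) (sym eq) upair-∋ˡ)
  ... | inj₁ h = sym h
  ... | inj₂ h = sym h

  abstract
    opair-injective : ∀ {a b c d} → opair a b ≡ opair c d → a ≡ c × b ≡ d
    opair-injective {a} {b} {c} {d} eq
      -- The set `{a}` equals `{c}` or `{c, d}`, and either equation forces `a ≡ c`. Equal first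
      -- members can then be cancelled twice.
      with [ upair-diagonal , upair-diagonal ]′ (upair-∈ (subst (upair a a ε_) eq upair-∋ˡ))
    ... | refl = refl , upair-injʳ (upair-injʳ eq)

  OPair-injective : ∀ {p a b c d} → OPair 𝓜 p a b → OPair 𝓜 p c d → a ≡ c × b ≡ d
  OPair-injective h k = opair-injective (trans (sym (OPair⇒≡ h)) (OPair⇒≡ k))

  opair∈⇒Pair∈ : ∀ {g a b} → opair a b ε g → Pair∈ 𝓜 g a b
  opair∈⇒Pair∈ h = _ , opair-OPair _ _ , h

  Pair∈⇒opair∈ : ∀ {g a b} → Pair∈ 𝓜 g a b → opair a b ε g
  Pair∈⇒opair∈ {g} (p , h , p∈g) = subst (_ε g) (OPair⇒≡ h) p∈g

  opair∈⇒Triple∈ : ∀ {g a b c} → opair a (opair b c) ε g → Triple∈ 𝓜 g a b c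
  opair∈⇒Triple∈ h = _ , opair-OPair _ _ , opair∈⇒Pair∈ h

  Triple∈⇒opair∈ : ∀ {g a b c} → Triple∈ 𝓜 g a b c → opair a (opair b c) ε g
  Triple∈⇒opair∈ {g} {a} (q , h , t) =
    subst (λ q → opair a q ε g) (OPair⇒≡ h) (Pair∈⇒opair∈ t)

  abstract
    -- Replacement along the identity restricted to `X` has image `a ∩ X`. Since the class function
    -- need not be total, no default value is required.
    separation : ∀ {X} → X ∈ 𝔛 → ∀ a → ∃[ b ] ∀ x → (x ε b) ⇔ (x ε a × x ∈ X)
    separation {X} X∈𝔛 a
      with replacement Identity Identity∈𝔛 functional a
      where
        Identity : Pred M ℓ
        Identity p = ∃[ x ] (OPair 𝓜 p x x × x ∈ X)
        Identity∈𝔛 : Identity ∈ 𝔛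
        Identity∈𝔛 = expressible∈𝔛 0 {Y = X ∷ []}
          (∃ᵉ (OPairᵉ x1 x0 x0 ∧ᵉ classᵉ x0 x0)) (X∈𝔛 ∷ []) _
        functional : ∀ {p q x y z} → OPair 𝓜 p x y → OPair 𝓜 q x z →
                     Identity p → Identity q → y ≡ z
        functional h k (_ , h′ , _) (_ , k′ , _)
          with OPair-injective h h′ | OPair-injective k k′
        ... | refl , refl | refl , refl = refl
    ... | b , b-spec = b , λ x → mk⇔
        (λ x∈b → fixes (to (b-spec x) x∈b))
        (λ (x∈a , x∈X) → from (b-spec x)
          (x , opair x x , x∈a , opair-OPair x x , x , opair-OPair x x , x∈X))
      where
        fixes : ∀ {y} → ∃[ x ] ∃[ p ] (x ε a × OPair 𝓜 p x y ×
                  ∃[ z ] (OPair 𝓜 p z z × z ∈ X)) → y ε a × y ∈ X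
        fixes (x , p , x∈a , h , z , k , z∈X) with OPair-injective h k
        ... | refl , refl = x∈a , z∈X

    ∅ : M
    ∅ = proj₁ (separation (expressible∈𝔛 0 {Y = []} (¬ᵉ (≡ᵉ x0 x0)) [] _) inhabited)

    ∅-Empty : Empty 𝓜 ∅
    ∅-Empty x x∈∅ = proj₂
      (to (proj₂ (separation (expressible∈𝔛 0 (¬ᵉ (≡ᵉ x0 x0)) [] _) inhabited) x) x∈∅)
      refl

  Empty⇒≡ : ∀ {e} → Empty 𝓜 e → e ≡ ∅
  Empty⇒≡ h = extensionality _ _ λ x →
    mk⇔ (λ x∈e → ⊥-elim (h x x∈e)) (λ x∈∅ → ⊥-elim (∅-Empty x x∈∅))

  abstract
    ⋃ : M → M
    ⋃ a = proj₁ (union a)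

    ∈-⋃ : ∀ {x y a} → x ε y → y ε a → x ε ⋃ a
    ∈-⋃ x∈y y∈a = from (proj₂ (union _) _) (_ , y∈a , x∈y)

  infixl 6 _∪_

  abstract
    _∪_ : M → M → M
    a ∪ b = ⋃ (upair a b)

    ∪-spec : ∀ a b x → (x ε a ∪ b) ⇔ (x ε a ⊎ x ε b)
    ∪-spec a b x = mk⇔
      (λ h → split (to (proj₂ (union _) x) h))
      [ (λ h → ∈-⋃ h upair-∋ˡ) , (λ h → ∈-⋃ h upair-∋ʳ) ]′
      where
        split : ∃[ y ] (y ε upair a b × x ε y) → x ε a ⊎ x ε b
        split (y , y∈ , x∈y) with upair-∈ y∈
        ... | inj₁ refl = inj₁ x∈y
        ... | inj₂ refl = inj₂ x∈y

  abstract
    adjoin : M → M → M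
    adjoin b a = b ∪ upair a a

    adjoin-Adjoin : ∀ b a → Adjoin 𝓜 (adjoin b a) b a
    adjoin-Adjoin b a x = mk⇔
      (λ h → [ inj₁ , (λ h′ → inj₂ ([ id , id ]′ (upair-∈ h′))) ]′ (to (∪-spec _ _ x) h))
      (λ h → from (∪-spec _ _ x) ([ inj₁ , (λ { refl → inj₂ upair-∋ˡ }) ]′ h))

  Adjoin⇒≡ : ∀ {c b a} → Adjoin 𝓜 c b a → c ≡ adjoin b a
  Adjoin⇒≡ h = ext h (adjoin-Adjoin _ _)

  adjoin-∋ : ∀ {b a} → a ε adjoin b a
  adjoin-∋ = from (adjoin-Adjoin _ _ _) (inj₂ refl)

  adjoin-⊇ : ∀ {x b a} → x ε b → x ε adjoin b a
  adjoin-⊇ h = from (adjoin-Adjoin _ _ _) (inj₁ h)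

  adjoin-∈ : ∀ {x b a} → x ε adjoin b a → x ε b ⊎ x ≡ a
  adjoin-∈ = to (adjoin-Adjoin _ _ _)

  -- Foundation speaks of sets only; it is applied to `a ∩ X`, which separation provides.
  minimal : ∀ {X} → X ∈ 𝔛 → ∀ {a} x → x ε a → x ∈ X →
            ∃[ y ] (y ε a × y ∈ X × ∀ z → z ε y → z ε a → ¬ (z ∈ X))
  minimal X∈𝔛 {a} x x∈a x∈X with separation X∈𝔛 a
  ... | b , b-spec with foundation b (x , from (b-spec x) (x∈a , x∈X))
  ... | y , y∈b , y-min = y , proj₁ (to (b-spec y) y∈b) , proj₂ (to (b-spec y) y∈b) ,
        λ z z∈y z∈a z∈X → y-min z z∈y (from (b-spec z) (z∈a , z∈X))

  ε-irrefl : ∀ x → ¬ (x ε x)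
  ε-irrefl x x∈x with foundation (upair x x) (x , upair-∋ˡ)
  ... | y , y∈ , y-min with [ id , id ]′ (upair-∈ y∈)
  ... | refl = y-min x x∈x upair-∋ˡ

  num : ℕ → M
  num zero    = ∅
  num (suc n) = adjoin (num n) (num n)

  num-Numeral : ∀ n → Numeral 𝓜 n (num n)
  num-Numeral zero    = ∅-Empty
  num-Numeral (suc n) = num n , num-Numeral n , adjoin-Adjoin _ _

  Numeral⇒≡ : ∀ n {a} → Numeral 𝓜 n a → a ≡ num n
  Numeral⇒≡ zero    h = Empty⇒≡ h
  Numeral⇒≡ (suc n) (b , h , s) with Numeral⇒≡ n h
  ... | refl = Adjoin⇒≡ s

  num-Standard : ∀ n → Standard 𝓜 (num n)
  num-Standard n = n , num-Numeral n

  ∈num : ∀ n {x} → x ε num n → ∃[ j ] (j < n × x ≡ num j)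
  ∈num zero    h = ⊥-elim (∅-Empty _ h)
  ∈num (suc n) h with adjoin-∈ h
  ... | inj₂ refl = n , ≤-refl , refl
  ... | inj₁ h′ with ∈num n h′
  ... | j , j<n , eq = j , m<n⇒m<1+n j<n , eq

  num-∈ : ∀ {n j} → j < n → num j ε num n
  num-∈ {suc n} (s≤s j≤n) with m≤n⇒m<n∨m≡n j≤n
  ... | inj₁ j<n  = adjoin-⊇ (num-∈ j<n)
  ... | inj₂ refl = adjoin-∋

  num-injective : ∀ {m n} → num m ≡ num n → m ≡ n
  num-injective {m} {n} eq with <-cmp m n
  ... | tri≈ _ m≡n _ = m≡n
  ... | tri< m<n _ _ = ⊥-elim (ε-irrefl _ (subst (_ε num n) eq (num-∈ m<n)))
  ... | tri> _ _ n<m = ⊥-elim (ε-irrefl _ (subst (num n ε_) eq (num-∈ n<m)))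

  ≼num : ∀ {x} n → _≼_ 𝓜 x (num n) → ∃[ j ] (j ≤ n × x ≡ num j)
  ≼num n (inj₂ eq) = n , ≤-refl , eq
  ≼num n (inj₁ h) with ∈num n h
  ... | j , j<n , eq = j , <⇒≤ j<n , eq

  num-≼ : ∀ {n j} → j ≤ n → _≼_ 𝓜 (num j) (num n)
  num-≼ j≤n with m≤n⇒m<n∨m≡n j≤n
  ... | inj₁ j<n  = inj₁ (num-∈ j<n)
  ... | inj₂ refl = inj₂ refl

  num-FiniteOrdinal : ∀ n → FiniteOrdinal 𝓜 (num n)
  num-FiniteOrdinal n = (transitive , trichotomous) , predecessor
    where
      transitive : Transitive 𝓜 (num n)
      transitive x x∈n y y∈x with ∈num n x∈n
      ... | j , j<n , refl with ∈num j y∈x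
      ... | i , i<j , refl = num-∈ (<-trans i<j j<n)
      trichotomous : ∀ x y → x ε num n → y ε num n → x ε y ⊎ x ≡ y ⊎ y ε x
      trichotomous x y x∈n y∈n with ∈num n x∈n | ∈num n y∈n
      ... | i , _ , refl | j , _ , refl with <-cmp i j
      ... | tri< i<j _ _  = inj₁ (num-∈ i<j)
      ... | tri≈ _ refl _ = inj₂ (inj₁ refl)
      ... | tri> _ _ j<i  = inj₂ (inj₂ (num-∈ j<i))
      predecessor : ∀ m → _≼_ 𝓜 m (num n) → Empty 𝓜 m ⊎ ∃[ l ] Succ 𝓜 m l
      predecessor m m≼n with ≼num n m≼n
      ... | zero  , _ , refl = inj₁ ∅-Empty
      ... | suc j , _ , refl = inj₂ (num j , adjoin-Adjoin _ _)

  ≼num-suc⁻¹ : ∀ n {d e} → Succ 𝓜 d e → _≼_ 𝓜 d (num (suc n)) → _≼_ 𝓜 e (num n)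
  ≼num-suc⁻¹ n {e = e} s d≼ with ≼num (suc n) d≼
  ... | j , j≤ , refl with ∈num j (from (s e) (inj₂ refl))
  ... | i , i<j , refl = num-≼ (s≤s⁻¹ (≤-trans i<j j≤))

  ≼num-zero : ∀ {d e} → Succ 𝓜 d e → ¬ (_≼_ 𝓜 d (num 0))
  ≼num-zero {e = e} s d≼ with ≼num 0 d≼
  ... | .0 , z≤n , refl = ∅-Empty e (from (s e) (inj₂ refl))

  ≼num-trans : ∀ n {d e} → _≼_ 𝓜 d e → _≼_ 𝓜 e (num n) → _≼_ 𝓜 d (num n)
  ≼num-trans n d≼e e≼n with ≼num n e≼n
  ... | j , j≤n , refl with ≼num j d≼e
  ... | i , i≤j , refl = num-≼ (≤-trans i≤j j≤n)

  module _ {k} (k-fin : FiniteOrdinal 𝓜 k) where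

    -- A counterexample could be chosen ∈-minimal in `k ∪ {k}`, the set of all `y ≼ k`. It is empty
    -- or a successor because `k` is a finite ordinal; the base case excludes the former, and in the
    -- latter case its predecessor lies in `k` by transitivity, hence in `X`.
    finite-induction : ∀ {X} → X ∈ 𝔛 → num 0 ∈ X →
      (∀ {y l} → Succ 𝓜 y l → _≼_ 𝓜 l k → l ∈ X → y ∈ X) → ∀ {y} → _≼_ 𝓜 y k → y ∈ X
    finite-induction {X} X∈𝔛 base step y≼k = em⇒dne em λ y∉X →
        no-minimal (minimal {¬_ ∘ X} (expressible∈𝔛 0 (¬ᵉ (classᵉ x0 x0)) (X∈𝔛 ∷ []) _)
                            _ (from (adjoin-Adjoin k k _) y≼k) y∉X)
      where
        below : ∀ {y l} → _≼_ 𝓜 y k → l ε y → l ε k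
        below (inj₁ y∈k)  l∈y = proj₁ (proj₁ k-fin) _ y∈k _ l∈y
        below (inj₂ refl) l∈y = l∈y
        no-minimal : ¬ (∃[ y ] (y ε adjoin k k × ¬ X y × ∀ z → z ε y → z ε adjoin k k → ¬ ¬ X z))
        no-minimal (y , y∈ , y∉X , y-min) with proj₂ k-fin y (adjoin-∈ y∈)
        ... | inj₁ y-empty = y∉X (subst X (sym (Empty⇒≡ y-empty)) base)
        ... | inj₂ (l , s) = y-min l l∈y (adjoin-⊇ l∈k) λ l∈X → y∉X (step s (inj₁ l∈k) l∈X)
          where
            l∈y = from (s l) (inj₂ refl)
            l∈k = below (adjoin-∈ y∈) l∈y

    -- External induction on `n` with an internal induction along `k` at each stage: an ordinal
    -- having `num n` as an element is at least `num (suc n)`. Nonstandardness serves to exclude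
    -- `y ≡ num n`.
    num≼ : ∀ n {y} → _≼_ 𝓜 y k → ¬ Standard 𝓜 y → _≼_ 𝓜 (num n) y
    num≼ zero y≼k _ = finite-induction
      (expressible∈𝔛 1 {Y = []} (≼ᵉ x1 x0) [] (num 0 , _)) (inj₂ refl)
      (λ s _ → λ { (inj₁ h)    → inj₁ (from (s _) (inj₁ h))
                 ; (inj₂ refl) → inj₁ (from (s _) (inj₂ refl)) })
      y≼k
    num≼ (suc n) y≼k y-ns with num≼ n y≼k y-ns
    ... | inj₂ refl = ⊥-elim (y-ns (num-Standard n))
    ... | inj₁ n∈y  = finite-induction
      (expressible∈𝔛 2 {Y = []} (εᵉ x1 x0 ⇒ᵉ ≼ᵉ x2 x0) [] (num n , num (suc n) , _))
      (λ h → ⊥-elim (∅-Empty _ h)) step y≼k n∈y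
      where
        step : ∀ {y l} → Succ 𝓜 y l → _≼_ 𝓜 l k → (num n ε l → _≼_ 𝓜 (num (suc n)) l) →
               num n ε y → _≼_ 𝓜 (num (suc n)) y
        step s _ hyp n∈y with to (s _) n∈y
        ... | inj₂ refl = inj₂ (sym (Adjoin⇒≡ s))
        ... | inj₁ n∈l with hyp n∈l
        ... | inj₁ h    = inj₁ (from (s _) (inj₁ h))
        ... | inj₂ refl = inj₁ (from (s _) (inj₂ refl))

    num∈ : ∀ n {y} → _≼_ 𝓜 y k → ¬ Standard 𝓜 y → num n ε y
    num∈ n y≼k y-ns with num≼ n y≼k y-ns
    ... | inj₁ h    = h
    ... | inj₂ refl = ⊥-elim (y-ns (num-Standard n))

    -- Otherwise every member of `X` up to `k` would be standard. Then `X` would be closed under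
    -- successors up to `k`, since the successor of a numeral is a numeral, and internal induction
    -- would put the nonstandard `k` itself into `X`.
    overspill : ∀ {X} → ¬ Standard 𝓜 k → X ∈ 𝔛 → (∀ n → num n ∈ X) →
                ∃[ l ] ((∀ n → num n ε l) × l ∈ X)
    overspill {X} k-ns X∈𝔛 all = em⇒dne em λ none → none
      (k , (λ n → num∈ n (inj₂ refl) k-ns) , finite-induction X∈𝔛 (all 0) (step none) (inj₂ refl))
      where
        step : ¬ (∃[ l ] ((∀ n → num n ε l) × l ∈ X)) →
               ∀ {y l} → Succ 𝓜 y l → _≼_ 𝓜 l k → l ∈ X → y ∈ X
        step none s l≼k l∈X
          with em⇒dne em (λ l-ns → none (_ , (λ n → num∈ n l≼k l-ns) , l∈X))
        ... | n , h with Numeral⇒≡ n h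
        ... | refl = subst X (sym (Adjoin⇒≡ s)) (all (suc n))

-- Tagged codes, certificates, and inversion of substitution steps

module Coding {ℓ ℓ′} (em : ExcludedMiddle ℓ) (𝓜 : SetStructure ℓ)
  (𝔛 : Pred (Pred (SetStructure.Carrier 𝓜) ℓ) ℓ′) (gb : IsGB₀ 𝓜 𝔛) where

  open SetStructure 𝓜 renaming (Carrier to M)
  open Sets em 𝓜 𝔛 gb

  tag : ℕ → M → M
  tag n x = opair (num n) x

  tag₂ : ℕ → M → M → M
  tag₂ n x y = tag n (opair x y)

  tag-Tagged : ∀ n x → Tagged 𝓜 n (tag n x) x
  tag-Tagged n x = num n , num-Numeral n , opair-OPair _ _

  tag₂-Tagged₂ : ∀ n x y → Tagged₂ 𝓜 n (tag₂ n x y) x y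
  tag₂-Tagged₂ n x y = opair x y , opair-OPair x y , tag-Tagged n _

  Tagged⇒≡ : ∀ {n p x} → Tagged 𝓜 n p x → p ≡ tag n x
  Tagged⇒≡ {n} (t , h , o) with Numeral⇒≡ n h
  ... | refl = OPair⇒≡ o

  Tagged₂⇒≡ : ∀ {n p x y} → Tagged₂ 𝓜 n p x y → p ≡ tag₂ n x y
  Tagged₂⇒≡ (q , o , t) with OPair⇒≡ o
  ... | refl = Tagged⇒≡ t

  Tagged-injective : ∀ {m n p x y} → Tagged 𝓜 m p x → Tagged 𝓜 n p y → m ≡ n × x ≡ y
  Tagged-injective h k with opair-injective (trans (sym (Tagged⇒≡ h)) (Tagged⇒≡ k))
  ... | eq , x≡y = num-injective eq , x≡y

  Tagged₂-injective : ∀ {m n p x y x′ y′} → Tagged₂ 𝓜 m p x y → Tagged₂ 𝓜 n p x′ y′ →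
                      m ≡ n × x ≡ x′ × y ≡ y′
  Tagged₂-injective (q , o , h) (q′ , o′ , h′) with Tagged-injective h h′
  ... | m≡n , refl = m≡n , OPair-injective o o′

  untag₂ : ∀ {n p x y} → Tagged₂ 𝓜 n p x y → ∃[ q ] Tagged 𝓜 n p q
  untag₂ (q , _ , h) = q , h

  clash : ∀ {a} {A : Set a} {m n p} → ∃[ x ] Tagged 𝓜 m p x → ∃[ y ] Tagged 𝓜 n p y →
          ¬ (m ≡ n) → A
  clash (_ , h) (_ , k) m≢n = ⊥-elim (m≢n (proj₁ (Tagged-injective h k)))

  -- Inductive definitions inside `𝓜`: `J` gives the rules, and a certificate is a set each of whose
  -- coded elements follows by a rule from elements of the same set. Depth, substitution, decoding
  -- and primitive recursion all have this form.
  module Certificates {I : Set ℓ} (_∋_ : M → I → Set ℓ) (element : I → M)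
    (∋⇔ : ∀ g i → (g ∋ i) ⇔ (element i ε g))
    (element-injective : ∀ {i j} → element i ≡ element j → i ≡ j) where

    Certificate : ((I → Set ℓ) → I → Set ℓ) → M → Set ℓ
    Certificate J g = ∀ i → g ∋ i → J (g ∋_) i

    Derivable : ((I → Set ℓ) → I → Set ℓ) → I → Set ℓ
    Derivable J i = ∃[ g ] (Certificate J g × g ∋ i)

    module _ {J : (I → Set ℓ) → I → Set ℓ}
      (J-mono : ∀ {R S : I → Set ℓ} → (∀ i → R i → S i) → ∀ i → J R i → J S i) where

      private
        join : ∀ {is} → All (Derivable J) is →
               ∃[ g ] (Certificate J g × (∀ i → i ∈ˡ is → g ∋ i))
        join [] = ∅ , (λ i h → ⊥-elim (∅-Empty _ (to (∋⇔ _ i) h))) , λ i ()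
        join {i₀ ∷ is} ((g , g-cert , i∈g) ∷ ds) with join ds
        ... | g′ , g′-cert , is⊆g′ = g ∪ g′ , cert , elements
          where
            inˡ : ∀ i → g ∋ i → (g ∪ g′) ∋ i
            inˡ i h = from (∋⇔ _ i) (from (∪-spec g g′ _) (inj₁ (to (∋⇔ g i) h)))
            inʳ : ∀ i → g′ ∋ i → (g ∪ g′) ∋ i
            inʳ i h = from (∋⇔ _ i) (from (∪-spec g g′ _) (inj₂ (to (∋⇔ g′ i) h)))
            cert : Certificate J (g ∪ g′)
            cert i h with to (∪-spec g g′ _) (to (∋⇔ _ i) h)
            ... | inj₁ k = J-mono inˡ i (g-cert i (from (∋⇔ g i) k))
            ... | inj₂ k = J-mono inʳ i (g′-cert i (from (∋⇔ g′ i) k))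
            elements : ∀ i → i ∈ˡ i₀ ∷ is → (g ∪ g′) ∋ i
            elements i (here refl) = inˡ i i∈g
            elements i (there h)   = inʳ i (is⊆g′ i h)

      -- Monotone rules make certificates closed under union, so finitely many premises share one
      -- certificate, to which the conclusion is adjoined. Injectivity of `element` ensures that
      -- nothing else needs a justification.
      derive : ∀ {is i} → All (Derivable J) is → J (_∈ˡ is) i → Derivable J i
      derive {i = i} ds h with join ds
      ... | g , g-cert , is⊆g = adjoin g (element i) , cert , from (∋⇔ _ i) adjoin-∋
        where
          grow : ∀ j → g ∋ j → adjoin g (element i) ∋ j
          grow j k = from (∋⇔ _ j) (adjoin-⊇ (to (∋⇔ g j) k))
          cert : Certificate J (adjoin g (element i))
          cert j k with adjoin-∈ (to (∋⇔ _ j) k)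
          ... | inj₁ k′ = J-mono grow j (g-cert j (from (∋⇔ g j) k′))
          ... | inj₂ eq with element-injective eq
          ... | refl = J-mono (λ j′ → grow j′ ∘ is⊆g j′) j h

  module Pairs = Certificates {M × M}
    (λ g (a , b) → Pair∈ 𝓜 g a b) (λ (a , b) → opair a b)
    (λ g _ → mk⇔ Pair∈⇒opair∈ opair∈⇒Pair∈)
    (λ eq → cong₂ _,_ (proj₁ (opair-injective eq)) (proj₂ (opair-injective eq)))

  module Triples = Certificates {M × M × M}
    (λ g (a , b , c) → Triple∈ 𝓜 g a b c) (λ (a , b , c) → opair a (opair b c))
    (λ g _ → mk⇔ Triple∈⇒opair∈ opair∈⇒Triple∈)
    (λ eq → cong₂ _,_ (proj₁ (opair-injective eq))
      (cong₂ _,_ (proj₁ (opair-injective (proj₂ (opair-injective eq))))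
                 (proj₂ (opair-injective (proj₂ (opair-injective eq))))))

  -- The body of `DepthCertificate` with the pair relation abstracted. Keeping its shape verbatim
  -- makes the passage between the two notions of certificate mere currying.
  DepthStep : (M × M → Set ℓ) → M × M → Set ℓ
  DepthStep R (φ , d) =
      (IsAtomic 𝓜 φ × Empty 𝓜 d)
    ⊎ (∃[ ψ ] ∃[ e ] (IsNeg 𝓜 φ ψ × R (ψ , e) × Succ 𝓜 d e))
    ⊎ (∃[ ψ ] ∃[ χ ] ∃[ e ] ∃[ e′ ] ∃[ m ]
         (IsOr 𝓜 φ ψ χ × R (ψ , e) × R (χ , e′) × IsMax 𝓜 m e e′ × Succ 𝓜 d m))
    ⊎ (∃[ i ] ∃[ ψ ] ∃[ e ] (IsEx 𝓜 φ i ψ × R (ψ , e) × Succ 𝓜 d e))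

  SubstStep : M → (M × M × M → Set ℓ) → M × M × M → Set ℓ
  SubstStep α R (φ , b , s) =
      (∃[ t ] ∃[ t′ ] ∃[ u ] ∃[ u′ ]
         (TermSubst 𝓜 α b t u × TermSubst 𝓜 α b t′ u′ ×
          ((IsEq 𝓜 φ t t′ × IsEq 𝓜 s u u′) ⊎ (IsMem 𝓜 φ t t′ × IsMem 𝓜 s u u′))))
    ⊎ (∃[ ψ ] ∃[ r ] (IsNeg 𝓜 φ ψ × IsNeg 𝓜 s r × R (ψ , b , r)))
    ⊎ (∃[ ψ ] ∃[ χ ] ∃[ r ] ∃[ q ]
         (IsOr 𝓜 φ ψ χ × IsOr 𝓜 s r q × R (ψ , b , r) × R (χ , b , q)))
    ⊎ (∃[ i ] ∃[ ψ ] ∃[ r ] ∃[ b′ ]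
         (IsEx 𝓜 φ i ψ × IsEx 𝓜 s i r × Adjoin 𝓜 b′ b i × R (ψ , b′ , r)))

  DepthStep-mono : ∀ {R S : M × M → Set ℓ} → (∀ i → R i → S i) →
                   ∀ i → DepthStep R i → DepthStep S i
  DepthStep-mono f _ (inj₁ h) = inj₁ h
  DepthStep-mono f _ (inj₂ (inj₁ (ψ , e , h , r , s))) = inj₂ (inj₁ (ψ , e , h , f _ r , s))
  DepthStep-mono f _ (inj₂ (inj₂ (inj₁ (ψ , χ , e , e′ , m , h , r , r′ , s)))) =
    inj₂ (inj₂ (inj₁ (ψ , χ , e , e′ , m , h , f _ r , f _ r′ , s)))
  DepthStep-mono f _ (inj₂ (inj₂ (inj₂ (i , ψ , e , h , r , s)))) =
    inj₂ (inj₂ (inj₂ (i , ψ , e , h , f _ r , s)))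

  SubstStep-mono : ∀ α {R S : M × M × M → Set ℓ} → (∀ i → R i → S i) →
                   ∀ i → SubstStep α R i → SubstStep α S i
  SubstStep-mono α f _ (inj₁ h) = inj₁ h
  SubstStep-mono α f _ (inj₂ (inj₁ (ψ , r , h , k , t))) = inj₂ (inj₁ (ψ , r , h , k , f _ t))
  SubstStep-mono α f _ (inj₂ (inj₂ (inj₁ (ψ , χ , r , q , h , k , t , t′)))) =
    inj₂ (inj₂ (inj₁ (ψ , χ , r , q , h , k , f _ t , f _ t′)))
  SubstStep-mono α f _ (inj₂ (inj₂ (inj₂ (i , ψ , r , b′ , h , k , a , t)))) =
    inj₂ (inj₂ (inj₂ (i , ψ , r , b′ , h , k , a , f _ t)))

  Derivable⇒HasDepth : ∀ {φ d} → Pairs.Derivable DepthStep (φ , d) → HasDepth 𝓜 φ d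
  Derivable⇒HasDepth (g , c , h) = g , (λ φ d → c (φ , d)) , h

  Derivable⇒Subst : ∀ {φ α s} → Triples.Derivable (SubstStep α) (φ , ∅ , s) → Subst 𝓜 φ α s
  Derivable⇒Subst (g , c , h) = g , ∅ , ∅-Empty , (λ φ b s → c (φ , b , s)) , h

  data SubstCase (α : M) (R : M × M × M → Set ℓ) (φ b s : M) : Set ℓ where
    eq-case : ∀ {t t′ u u′} → TermSubst 𝓜 α b t u → TermSubst 𝓜 α b t′ u′ →
      IsEq 𝓜 φ t t′ → IsEq 𝓜 s u u′ → SubstCase α R φ b s
    mem-case : ∀ {t t′ u u′} → TermSubst 𝓜 α b t u → TermSubst 𝓜 α b t′ u′ →
      IsMem 𝓜 φ t t′ → IsMem 𝓜 s u u′ → SubstCase α R φ b s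
    neg-case : ∀ {ψ r} → IsNeg 𝓜 φ ψ → IsNeg 𝓜 s r → R (ψ , b , r) → SubstCase α R φ b s
    or-case : ∀ {ψ χ r q} → IsOr 𝓜 φ ψ χ → IsOr 𝓜 s r q →
      R (ψ , b , r) → R (χ , b , q) → SubstCase α R φ b s
    ex-case : ∀ {i ψ r b′} → IsEx 𝓜 φ i ψ → IsEx 𝓜 s i r → Adjoin 𝓜 b′ b i →
      R (ψ , b′ , r) → SubstCase α R φ b s

  substCase : ∀ {α R φ b s} → SubstStep α R (φ , b , s) → SubstCase α R φ b s
  substCase (inj₁ (_ , _ , _ , _ , σ , σ′ , inj₁ (h , k))) = eq-case σ σ′ h k
  substCase (inj₁ (_ , _ , _ , _ , σ , σ′ , inj₂ (h , k))) = mem-case σ σ′ h k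
  substCase (inj₂ (inj₁ (_ , _ , h , k , x))) = neg-case h k x
  substCase (inj₂ (inj₂ (inj₁ (_ , _ , _ , _ , h , k , x , y)))) = or-case h k x y
  substCase (inj₂ (inj₂ (inj₂ (_ , _ , _ , _ , h , k , a , x)))) = ex-case h k a x

  module _ {α : M} {R : M × M × M → Set ℓ} {φ b s : M} (step : SubstStep α R (φ , b , s)) where

    invert-eq : ∀ {t t′} → IsEq 𝓜 φ t t′ →
      ∃[ u ] ∃[ u′ ] (TermSubst 𝓜 α b t u × TermSubst 𝓜 α b t′ u′ × IsEq 𝓜 s u u′)
    invert-eq h with substCase step
    ... | mem-case _ _ k _ = clash (untag₂ h) (untag₂ k) λ ()
    ... | neg-case k _ _ = clash (untag₂ h) (_ , k) λ ()
    ... | or-case k _ _ _ = clash (untag₂ h) (untag₂ k) λ ()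
    ... | ex-case (_ , k) _ _ _ = clash (untag₂ h) (untag₂ k) λ ()
    ... | eq-case σ σ′ k l with Tagged₂-injective h k
    ... | _ , refl , refl = _ , _ , σ , σ′ , l

    invert-mem : ∀ {t t′} → IsMem 𝓜 φ t t′ →
      ∃[ u ] ∃[ u′ ] (TermSubst 𝓜 α b t u × TermSubst 𝓜 α b t′ u′ × IsMem 𝓜 s u u′)
    invert-mem h with substCase step
    ... | eq-case _ _ k _ = clash (untag₂ h) (untag₂ k) λ ()
    ... | neg-case k _ _ = clash (untag₂ h) (_ , k) λ ()
    ... | or-case k _ _ _ = clash (untag₂ h) (untag₂ k) λ ()
    ... | ex-case (_ , k) _ _ _ = clash (untag₂ h) (untag₂ k) λ ()
    ... | mem-case σ σ′ k l with Tagged₂-injective h k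
    ... | _ , refl , refl = _ , _ , σ , σ′ , l

    invert-neg : ∀ {ψ} → IsNeg 𝓜 φ ψ → ∃[ r ] (IsNeg 𝓜 s r × R (ψ , b , r))
    invert-neg h with substCase step
    ... | eq-case _ _ k _ = clash (_ , h) (untag₂ k) λ ()
    ... | mem-case _ _ k _ = clash (_ , h) (untag₂ k) λ ()
    ... | or-case k _ _ _ = clash (_ , h) (untag₂ k) λ ()
    ... | ex-case (_ , k) _ _ _ = clash (_ , h) (untag₂ k) λ ()
    ... | neg-case k l x with Tagged-injective h k
    ... | _ , refl = _ , l , x

    invert-or : ∀ {ψ χ} → IsOr 𝓜 φ ψ χ →
      ∃[ r ] ∃[ q ] (IsOr 𝓜 s r q × R (ψ , b , r) × R (χ , b , q))
    invert-or h with substCase step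
    ... | eq-case _ _ k _ = clash (untag₂ h) (untag₂ k) λ ()
    ... | mem-case _ _ k _ = clash (untag₂ h) (untag₂ k) λ ()
    ... | neg-case k _ _ = clash (untag₂ h) (_ , k) λ ()
    ... | ex-case (_ , k) _ _ _ = clash (untag₂ h) (untag₂ k) λ ()
    ... | or-case k l x y with Tagged₂-injective h k
    ... | _ , refl , refl = _ , _ , l , x , y

    invert-ex : ∀ {i ψ} → IsEx 𝓜 φ i ψ →
      ∃[ r ] ∃[ b′ ] (IsEx 𝓜 s i r × Adjoin 𝓜 b′ b i × R (ψ , b′ , r))
    invert-ex (_ , h) with substCase step
    ... | eq-case _ _ k _ = clash (untag₂ h) (untag₂ k) λ ()
    ... | mem-case _ _ k _ = clash (untag₂ h) (untag₂ k) λ ()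
    ... | neg-case k _ _ = clash (untag₂ h) (_ , k) λ ()
    ... | or-case k _ _ _ = clash (untag₂ h) (untag₂ k) λ ()
    ... | ex-case (_ , k) l a x with Tagged₂-injective h k
    ... | _ , refl , refl = _ , _ , l , a , x

    invert-neg′ : ∀ {r} → IsNeg 𝓜 s r → ∃[ ψ ] (IsNeg 𝓜 φ ψ × R (ψ , b , r))
    invert-neg′ h with substCase step
    ... | eq-case _ _ _ k = clash (_ , h) (untag₂ k) λ ()
    ... | mem-case _ _ _ k = clash (_ , h) (untag₂ k) λ ()
    ... | or-case _ k _ _ = clash (_ , h) (untag₂ k) λ ()
    ... | ex-case _ (_ , k) _ _ = clash (_ , h) (untag₂ k) λ ()
    ... | neg-case l k x with Tagged-injective h k
    ... | _ , refl = _ , l , x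

    invert-or′ : ∀ {r q} → IsOr 𝓜 s r q →
      ∃[ ψ ] ∃[ χ ] (IsOr 𝓜 φ ψ χ × R (ψ , b , r) × R (χ , b , q))
    invert-or′ h with substCase step
    ... | eq-case _ _ _ k = clash (untag₂ h) (untag₂ k) λ ()
    ... | mem-case _ _ _ k = clash (untag₂ h) (untag₂ k) λ ()
    ... | neg-case _ k _ = clash (untag₂ h) (_ , k) λ ()
    ... | ex-case _ (_ , k) _ _ = clash (untag₂ h) (untag₂ k) λ ()
    ... | or-case l k x y with Tagged₂-injective h k
    ... | _ , refl , refl = _ , _ , l , x , y

    invert-ex′ : ∀ {i r} → IsEx 𝓜 s i r →
      ∃[ ψ ] ∃[ b′ ] (IsEx 𝓜 φ i ψ × Adjoin 𝓜 b′ b i × R (ψ , b′ , r))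
    invert-ex′ (_ , h) with substCase step
    ... | eq-case _ _ _ k = clash (untag₂ h) (untag₂ k) λ ()
    ... | mem-case _ _ _ k = clash (untag₂ h) (untag₂ k) λ ()
    ... | neg-case _ k _ = clash (untag₂ h) (_ , k) λ ()
    ... | or-case _ k _ _ = clash (untag₂ h) (untag₂ k) λ ()
    ... | ex-case l (_ , k) a x with Tagged₂-injective h k
    ... | _ , refl , refl = _ , _ , l , a , x

-- Truth classes for standard depths

module StandardTruth {ℓ ℓ′} (em : ExcludedMiddle ℓ) (𝓜 : SetStructure ℓ)
  (𝔛 : Pred (Pred (SetStructure.Carrier 𝓜) ℓ) ℓ′) (gb : IsGB₀ 𝓜 𝔛) where

  open SetStructure 𝓜 renaming (Carrier to M)
  open Expressibility em 𝓜
  open Sets em 𝓜 𝔛 gb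
  open Coding em 𝓜 𝔛 gb

  data DepthCase (R : M × M → Set ℓ) (φ d : M) : Set ℓ where
    eq-case : ∀ {t u} → IsEq 𝓜 φ t u → DepthCase R φ d
    mem-case : ∀ {t u} → IsMem 𝓜 φ t u → DepthCase R φ d
    neg-case : ∀ {ψ e} → IsNeg 𝓜 φ ψ → R (ψ , e) → Succ 𝓜 d e → DepthCase R φ d
    or-case : ∀ {ψ χ e e′ m} → IsOr 𝓜 φ ψ χ → R (ψ , e) → R (χ , e′) →
      _≼_ 𝓜 e m → _≼_ 𝓜 e′ m → Succ 𝓜 d m → DepthCase R φ d
    ex-case : ∀ {i ψ e} → IsEx 𝓜 φ i ψ → R (ψ , e) → Succ 𝓜 d e → DepthCase R φ d

  depthCase : ∀ {R φ d} → DepthStep R (φ , d) → DepthCase R φ d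
  depthCase (inj₁ ((_ , _ , _ , _ , inj₁ h) , _)) = eq-case h
  depthCase (inj₁ ((_ , _ , _ , _ , inj₂ h) , _)) = mem-case h
  depthCase (inj₂ (inj₁ (_ , _ , h , x , s))) = neg-case h x s
  depthCase (inj₂ (inj₂ (inj₁ (_ , _ , _ , _ , _ , h , x , y , inj₁ (l , refl) , s)))) =
    or-case h x y l (inj₂ refl) s
  depthCase (inj₂ (inj₂ (inj₁ (_ , _ , _ , _ , _ , h , x , y , inj₂ (l , refl) , s)))) =
    or-case h x y (inj₂ refl) l s
  depthCase (inj₂ (inj₂ (inj₂ (_ , _ , _ , h , x , s)))) = ex-case h x s

  module _ {R : M × M → Set ℓ} {φ d : M} (step : DepthStep R (φ , d)) where

    depth-neg : ∀ {ψ} → IsNeg 𝓜 φ ψ → ∃[ e ] (R (ψ , e) × Succ 𝓜 d e)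
    depth-neg h with depthCase step
    ... | eq-case k = clash (_ , h) (untag₂ k) λ ()
    ... | mem-case k = clash (_ , h) (untag₂ k) λ ()
    ... | or-case k _ _ _ _ _ = clash (_ , h) (untag₂ k) λ ()
    ... | ex-case (_ , k) _ _ = clash (_ , h) (untag₂ k) λ ()
    ... | neg-case k x s with Tagged-injective h k
    ... | _ , refl = _ , x , s

    depth-or : ∀ {ψ χ} → IsOr 𝓜 φ ψ χ → ∃[ e ] ∃[ e′ ] ∃[ m ]
      (R (ψ , e) × R (χ , e′) × _≼_ 𝓜 e m × _≼_ 𝓜 e′ m × Succ 𝓜 d m)
    depth-or h with depthCase step
    ... | eq-case k = clash (untag₂ h) (untag₂ k) λ ()
    ... | mem-case k = clash (untag₂ h) (untag₂ k) λ ()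
    ... | neg-case k _ _ = clash (untag₂ h) (_ , k) λ ()
    ... | ex-case (_ , k) _ _ = clash (untag₂ h) (untag₂ k) λ ()
    ... | or-case k x y l l′ s with Tagged₂-injective h k
    ... | _ , refl , refl = _ , _ , _ , x , y , l , l′ , s

    depth-ex : ∀ {i ψ} → IsEx 𝓜 φ i ψ → ∃[ e ] (R (ψ , e) × Succ 𝓜 d e)
    depth-ex (_ , h) with depthCase step
    ... | eq-case k = clash (untag₂ h) (untag₂ k) λ ()
    ... | mem-case k = clash (untag₂ h) (untag₂ k) λ ()
    ... | neg-case k _ _ = clash (untag₂ h) (_ , k) λ ()
    ... | or-case k _ _ _ _ _ = clash (untag₂ h) (untag₂ k) λ ()
    ... | ex-case (_ , k) x s with Tagged₂-injective h k
    ... | _ , refl , refl = _ , x , s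

  ≼num-pred : ∀ n {d e} → Succ 𝓜 d e → _≼_ 𝓜 d (num n) → ∃[ n′ ] (n ≡ suc n′ × _≼_ 𝓜 e (num n′))
  ≼num-pred zero    s d≼ = ⊥-elim (≼num-zero s d≼)
  ≼num-pred (suc n) s d≼ = n , refl , ≼num-suc⁻¹ n s d≼

  -- Substituting along α for all variables but vᵢ, and then x for vᵢ.
  module Compose {α β α′ i x : M}
    (β-at : ∀ {j a} → Pair∈ 𝓜 β j a → j ≡ i × a ≡ x)
    (α′-at : Pair∈ 𝓜 α′ i x)
    (α′-off : ∀ {j a} → Pair∈ 𝓜 α j a → ¬ (j ≡ i) → Pair∈ 𝓜 α′ j a) where

    TermSubst-β⇒α′ : ∀ {b t w} → TermSubst 𝓜 β b t w → TermSubst 𝓜 α′ b t w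
    TermSubst-β⇒α′ (inj₁ h) = inj₁ h
    TermSubst-β⇒α′ (inj₂ (inj₁ (j , a , v , j∉b , βja , c))) with β-at βja
    ... | refl , refl = inj₂ (inj₁ (i , x , v , j∉b , α′-at , c))
    TermSubst-β⇒α′ (inj₂ (inj₂ h)) = inj₂ (inj₂ h)

    TermSubst-compose : ∀ {b b₁ t u w} → Adjoin 𝓜 b₁ b i →
      TermSubst 𝓜 α b₁ t u → TermSubst 𝓜 β b u w → TermSubst 𝓜 α′ b t w
    TermSubst-compose A (inj₁ (_ , _ , _ , refl)) h = TermSubst-β⇒α′ h
    TermSubst-compose A (inj₂ (inj₂ (_ , _ , refl))) h = TermSubst-β⇒α′ h
    TermSubst-compose A (inj₂ (inj₁ (j , a , v , j∉b₁ , αja , c))) (inj₁ (_ , (_ , k) , _)) =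
      clash (_ , c) (_ , k) λ ()
    TermSubst-compose A (inj₂ (inj₁ (j , a , v , j∉b₁ , αja , c)))
      (inj₂ (inj₁ (_ , _ , (_ , k) , _))) = clash (_ , c) (_ , k) λ ()
    -- A variable replaced along `α` has its index outside `b₁`, hence different from `i`, where
    -- `α′` agrees with `α`; the resulting constant is left alone by `β`.
    TermSubst-compose A (inj₂ (inj₁ (j , a , v , j∉b₁ , αja , c))) (inj₂ (inj₂ (_ , _ , refl))) =
      inj₂ (inj₁ (j , a , v , (λ j∈b → j∉b₁ (from (A j) (inj₁ j∈b))) ,
        α′-off αja (λ j≡i → j∉b₁ (from (A j) (inj₂ j≡i))) , c))

    Adjoin-swap : ∀ {b b₁ b₁′ j} → Adjoin 𝓜 b₁ b i → Adjoin 𝓜 b₁′ b₁ j →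
                  ∀ {b′} → Adjoin 𝓜 b′ b j → Adjoin 𝓜 b₁′ b′ i
    Adjoin-swap A B C y = mk⇔
      (λ h → [ (λ h′ → [ inj₁ ∘ from (C y) ∘ inj₁ , inj₂ ]′ (to (A y) h′))
             , inj₁ ∘ from (C y) ∘ inj₂ ]′ (to (B y) h))
      (λ h → from (B y) ([ (λ h′ → [ inj₁ ∘ from (A y) ∘ inj₁ , inj₂ ]′ (to (C y) h′))
                         , inj₁ ∘ from (A y) ∘ inj₂ ]′ h))

    -- In the first substitution `i` counts as bound, so the free `vᵢ` survives it and is left for
    -- `β`. The recursion is on the bound `n` for the depth: `φ` is merely an element of `𝓜` and
    -- offers no external structure to recurse on.
    compose : ∀ n {gd g₁ g₂} →
      DepthCertificate 𝓜 gd → SubstCertificate 𝓜 α g₁ → SubstCertificate 𝓜 β g₂ →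
      ∀ {φ d b b₁ s r} → Pair∈ 𝓜 gd φ d → _≼_ 𝓜 d (num n) →
      Triple∈ 𝓜 g₁ φ b₁ s → Adjoin 𝓜 b₁ b i → Triple∈ 𝓜 g₂ s b r →
      Triples.Derivable (SubstStep α′) (φ , b , r)
    compose n Cd C₁ C₂ hd d≼ h₁ A h₂ with substCase (C₁ _ _ _ h₁)
    ... | eq-case σ σ′ p q with invert-eq (C₂ _ _ _ h₂) q
    ... | _ , _ , τ , τ′ , q′ = Triples.derive (SubstStep-mono α′) []
      (inj₁ (_ , _ , _ , _ , TermSubst-compose A σ τ , TermSubst-compose A σ′ τ′ , inj₁ (p , q′)))
    compose n Cd C₁ C₂ hd d≼ h₁ A h₂ | mem-case σ σ′ p q with invert-mem (C₂ _ _ _ h₂) q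
    ... | _ , _ , τ , τ′ , q′ = Triples.derive (SubstStep-mono α′) []
      (inj₁ (_ , _ , _ , _ , TermSubst-compose A σ τ , TermSubst-compose A σ′ τ′ , inj₂ (p , q′)))
    compose n Cd C₁ C₂ hd d≼ h₁ A h₂ | neg-case p q h₁′
      with invert-neg (C₂ _ _ _ h₂) q | depth-neg (Cd _ _ hd) p
    ... | _ , q′ , h₂′ | _ , hd′ , s with ≼num-pred n s d≼
    ... | n′ , refl , e≼ = Triples.derive (SubstStep-mono α′)
      (compose n′ Cd C₁ C₂ hd′ e≼ h₁′ A h₂′ ∷ [])
      (inj₂ (inj₁ (_ , _ , p , q′ , here refl)))
    compose n Cd C₁ C₂ hd d≼ h₁ A h₂ | or-case p q h₁ˡ h₁ʳ
      with invert-or (C₂ _ _ _ h₂) q | depth-or (Cd _ _ hd) p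
    ... | _ , _ , q′ , h₂ˡ , h₂ʳ | _ , _ , _ , hdˡ , hdʳ , lˡ , lʳ , s with ≼num-pred n s d≼
    ... | n′ , refl , m≼ = Triples.derive (SubstStep-mono α′)
      (compose n′ Cd C₁ C₂ hdˡ (≼num-trans n′ lˡ m≼) h₁ˡ A h₂ˡ ∷
       compose n′ Cd C₁ C₂ hdʳ (≼num-trans n′ lʳ m≼) h₁ʳ A h₂ʳ ∷ [])
      (inj₂ (inj₂ (inj₁ (_ , _ , _ , _ , p , q′ , here refl , there (here refl)))))
    compose n Cd C₁ C₂ hd d≼ h₁ A h₂ | ex-case p q B h₁′
      with invert-ex (C₂ _ _ _ h₂) q | depth-ex (Cd _ _ hd) p
    ... | _ , _ , q′ , B′ , h₂′ | _ , hd′ , s with ≼num-pred n s d≼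
    ... | n′ , refl , e≼ = Triples.derive (SubstStep-mono α′)
      (compose n′ Cd C₁ C₂ hd′ e≼ h₁′ (Adjoin-swap A B B′) h₂′ ∷ [])
      (inj₂ (inj₂ (inj₂ (_ , _ , _ , _ , p , q′ , B′ , here refl))))

  update : ∀ {α} i x → IsFunction 𝓜 α → ∃[ α′ ] (IsFunction 𝓜 α′ × Pair∈ 𝓜 α′ i x ×
    (∀ {j a} → Pair∈ 𝓜 α j a → ¬ (j ≡ i) → Pair∈ 𝓜 α′ j a))
  update {α} i x α-fun
    -- All pairs with first component `i` are removed before `⟨i, x⟩` is added, which keeps the
    -- assignment single-valued.
    with separation (expressible∈𝔛 1 {Y = []} (¬ᵉ (∃ᵉ (OPairᵉ x1 x2 x0))) [] (i , _)) α
  ... | α₀ , α₀-spec = adjoin α₀ (opair i x) , fun , opair∈⇒Pair∈ adjoin-∋ ,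
        λ h j≢i → opair∈⇒Pair∈ (adjoin-⊇ (from (α₀-spec _) (Pair∈⇒opair∈ h ,
          λ (a , o) → j≢i (proj₁ (OPair-injective (opair-OPair _ _) o)))))
    where
      member : ∀ {j a} → Pair∈ 𝓜 (adjoin α₀ (opair i x)) j a →
               (Pair∈ 𝓜 α j a × ¬ (j ≡ i)) ⊎ (j ≡ i × a ≡ x)
      member h with adjoin-∈ (Pair∈⇒opair∈ h)
      ... | inj₂ eq = inj₂ (opair-injective eq)
      ... | inj₁ k with to (α₀-spec _) k
      ... | k′ , ¬i = inj₁ (opair∈⇒Pair∈ k′ , λ { refl → ¬i (_ , opair-OPair _ _) })
      fun : IsFunction 𝓜 (adjoin α₀ (opair i x))
      fun j a b h k with member h | member k
      ... | inj₁ (h′ , _)   | inj₁ (k′ , _)    = α-fun j a b h′ k′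
      ... | inj₁ (_ , j≢i)  | inj₂ (j≡i , _)   = contradiction j≡i j≢i
      ... | inj₂ (j≡i , _)  | inj₁ (_ , j≢i)   = contradiction j≡i j≢i
      ... | inj₂ (_ , refl) | inj₂ (_ , refl)  = refl

  data Immediate (s : M) : M → Set ℓ where
    neg : ∀ {ψ} → IsNeg 𝓜 s ψ → Immediate s ψ
    orˡ : ∀ {ψ χ} → IsOr 𝓜 s ψ χ → Immediate s ψ
    orʳ : ∀ {ψ χ} → IsOr 𝓜 s ψ χ → Immediate s χ
    ex  : ∀ {i ψ x r} → IsEx 𝓜 s i ψ → Instance 𝓜 ψ i x r → Immediate s r

  -- Inverting the substitution certificate leads from an immediate subsentence to an immediate
  -- subformula of `φ`. An instance of a quantifier results from two substitutions, which `compose`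
  -- merges into one along the updated assignment.
  immediate-Sentence≤ : ∀ n {s ψ} → Sentence≤ 𝓜 (num n) s → Immediate s ψ →
                        ∃[ n′ ] (n ≡ suc n′ × Sentence≤ 𝓜 (num n′) ψ)
  immediate-Sentence≤ n (φ , α , (d , (gd , Cd , hd) , d≼) , fun , (g , e , e∅ , C , h)) (neg p)
    with invert-neg′ (C _ _ _ h) p
  ... | φ′ , p′ , h′ with depth-neg (Cd _ _ hd) p′
  ... | d′ , hd′ , s with ≼num-pred n s d≼
  ... | n′ , eq , d′≼ = n′ , eq , φ′ , α , (d′ , (gd , Cd , hd′) , d′≼) , fun ,
                        (g , e , e∅ , C , h′)
  immediate-Sentence≤ n (φ , α , (d , (gd , Cd , hd) , d≼) , fun , (g , e , e∅ , C , h)) (orˡ p)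
    with invert-or′ (C _ _ _ h) p
  ... | φ′ , _ , p′ , h′ , _ with depth-or (Cd _ _ hd) p′
  ... | d′ , _ , _ , hd′ , _ , l , _ , s with ≼num-pred n s d≼
  ... | n′ , eq , m≼ = n′ , eq , φ′ , α , (d′ , (gd , Cd , hd′) , ≼num-trans n′ l m≼) , fun ,
                       (g , e , e∅ , C , h′)
  immediate-Sentence≤ n (φ , α , (d , (gd , Cd , hd) , d≼) , fun , (g , e , e∅ , C , h)) (orʳ p)
    with invert-or′ (C _ _ _ h) p
  ... | _ , φ′ , p′ , _ , h′ with depth-or (Cd _ _ hd) p′
  ... | _ , d′ , _ , _ , hd′ , _ , l , s with ≼num-pred n s d≼
  ... | n′ , eq , m≼ = n′ , eq , φ′ , α , (d′ , (gd , Cd , hd′) , ≼num-trans n′ l m≼) , fun ,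
                       (g , e , e∅ , C , h′)
  immediate-Sentence≤ n (φ , α , (d , (gd , Cd , hd) , d≼) , fun , (g , e , e∅ , C , h))
    (ex {i} {ψ} {x} p (q , β , o , u , (g₂ , e₂ , e₂∅ , C₂ , h₂)))
    with invert-ex′ (C _ _ _ h) p | update i x fun
  ... | φ′ , b , p′ , A , h′ | α′ , fun′ , at , off with depth-ex (Cd _ _ hd) p′
  ... | d′ , hd′ , s with ≼num-pred n s d≼ | trans (Empty⇒≡ e∅) (sym (Empty⇒≡ e₂∅)) | Empty⇒≡ e∅
  ... | n′ , eq , d′≼ | refl | refl = n′ , eq , φ′ , α′ , (d′ , (gd , Cd , hd′) , d′≼) , fun′ ,
      Derivable⇒Subst (compose n′ Cd C C₂ hd′ d′≼ h′ A h₂)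
    where
      β-at : ∀ {j a} → Pair∈ 𝓜 β j a → j ≡ i × a ≡ x
      β-at (p , o′ , p∈β) with [ id , id ]′ (to (u p) p∈β)
      ... | refl = OPair-injective o′ o
      open Compose β-at at off

  Sentence≤-suc : ∀ n {s} → Sentence≤ 𝓜 (num n) s → Sentence≤ 𝓜 (num (suc n)) s
  Sentence≤-suc n (φ , α , (d , D , d≼) , rest) =
    φ , α , (d , D , inj₁ (from (adjoin-Adjoin _ _ _) d≼)) , rest

  data TruthCase (U : Pred M ℓ) (s : M) : Set ℓ where
    eq-case : ∀ {t u a b} → IsConst 𝓜 t a → IsConst 𝓜 u b → IsEq 𝓜 s t u → a ≡ b → TruthCase U s
    mem-case : ∀ {t u a b} → IsConst 𝓜 t a → IsConst 𝓜 u b → IsMem 𝓜 s t u → a ε b →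
      TruthCase U s
    neg-case : ∀ {ψ} → IsNeg 𝓜 s ψ → ¬ U ψ → TruthCase U s
    or-case : ∀ {ψ χ} → IsOr 𝓜 s ψ χ → U ψ ⊎ U χ → TruthCase U s
    ex-case : ∀ {i ψ} → IsEx 𝓜 s i ψ → ∃[ x ] ∃[ r ] (Instance 𝓜 ψ i x r × U r) → TruthCase U s

  TruthStep : Pred M ℓ → Pred M ℓ
  TruthStep U s =
      (∃[ t ] ∃[ u ] ∃[ a ] ∃[ b ] (IsConst 𝓜 t a × IsConst 𝓜 u b ×
        ((IsEq 𝓜 s t u × a ≡ b) ⊎ (IsMem 𝓜 s t u × a ε b))))
    ⊎ (∃[ ψ ] (IsNeg 𝓜 s ψ × ¬ U ψ))
    ⊎ (∃[ ψ ] ∃[ χ ] (IsOr 𝓜 s ψ χ × (U ψ ⊎ U χ)))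
    ⊎ (∃[ i ] ∃[ ψ ] (IsEx 𝓜 s i ψ × ∃[ x ] ∃[ r ] (Instance 𝓜 ψ i x r × U r)))

  TruthStepᵉ : ∀ {c n} {Y : Vec (Pred M ℓ) c} j (s : Fin n) →
               Expressible Y (λ e → TruthStep (lookup Y j) (e ! s))
  TruthStepᵉ j s =
       ∃ᵉ (∃ᵉ (∃ᵉ (∃ᵉ (Taggedᵉ 1 x3 x1 ∧ᵉ Taggedᵉ 1 x2 x0 ∧ᵉ
         ((Tagged₂ᵉ 2 (4 ↑ʳ s) x3 x2 ∧ᵉ ≡ᵉ x1 x0) ∨ᵉ (Tagged₂ᵉ 3 (4 ↑ʳ s) x3 x2 ∧ᵉ εᵉ x1 x0))))))
    ∨ᵉ ∃ᵉ (Taggedᵉ 4 (1 ↑ʳ s) x0 ∧ᵉ ¬ᵉ (classᵉ j x0))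
    ∨ᵉ ∃ᵉ (∃ᵉ (Tagged₂ᵉ 5 (2 ↑ʳ s) x1 x0 ∧ᵉ (classᵉ j x1 ∨ᵉ classᵉ j x0)))
    ∨ᵉ ∃ᵉ (∃ᵉ (IsExᵉ (2 ↑ʳ s) x1 x0 ∧ᵉ ∃ᵉ (∃ᵉ (Instanceᵉ x2 x3 x1 x0 ∧ᵉ classᵉ j x0))))

  truthCase : ∀ {U s} → TruthStep U s → TruthCase U s
  truthCase (inj₁ (_ , _ , _ , _ , h , k , inj₁ (p , x))) = eq-case h k p x
  truthCase (inj₁ (_ , _ , _ , _ , h , k , inj₂ (p , x))) = mem-case h k p x
  truthCase (inj₂ (inj₁ (_ , p , x))) = neg-case p x
  truthCase (inj₂ (inj₂ (inj₁ (_ , _ , p , x)))) = or-case p x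
  truthCase (inj₂ (inj₂ (inj₂ (_ , _ , p , x)))) = ex-case p x

  module _ {U : Pred M ℓ} {s : M} where

    step-eq : ∀ {t u a b} → IsConst 𝓜 t a → IsConst 𝓜 u b → IsEq 𝓜 s t u →
              TruthStep U s ⇔ (a ≡ b)
    step-eq {t} {u} {a} {b} ta ub h =
      mk⇔ (read ∘ truthCase) (λ x → inj₁ (_ , _ , _ , _ , ta , ub , inj₁ (h , x)))
      where
        read : TruthCase U s → a ≡ b
        read (mem-case _ _ k _) = clash (untag₂ h) (untag₂ k) λ ()
        read (neg-case k _) = clash (untag₂ h) (_ , k) λ ()
        read (or-case k _) = clash (untag₂ h) (untag₂ k) λ ()
        read (ex-case (_ , k) _) = clash (untag₂ h) (untag₂ k) λ ()
        read (eq-case ta′ ub′ k x) with Tagged₂-injective h k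
        ... | _ , refl , refl with Tagged-injective ta ta′ | Tagged-injective ub ub′
        ... | _ , refl | _ , refl = x

    step-mem : ∀ {t u a b} → IsConst 𝓜 t a → IsConst 𝓜 u b → IsMem 𝓜 s t u →
               TruthStep U s ⇔ (a ε b)
    step-mem {t} {u} {a} {b} ta ub h =
      mk⇔ (read ∘ truthCase) (λ x → inj₁ (_ , _ , _ , _ , ta , ub , inj₂ (h , x)))
      where
        read : TruthCase U s → a ε b
        read (eq-case _ _ k _) = clash (untag₂ h) (untag₂ k) λ ()
        read (neg-case k _) = clash (untag₂ h) (_ , k) λ ()
        read (or-case k _) = clash (untag₂ h) (untag₂ k) λ ()
        read (ex-case (_ , k) _) = clash (untag₂ h) (untag₂ k) λ ()
        read (mem-case ta′ ub′ k x) with Tagged₂-injective h k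
        ... | _ , refl , refl with Tagged-injective ta ta′ | Tagged-injective ub ub′
        ... | _ , refl | _ , refl = x

    step-neg : ∀ {ψ} → IsNeg 𝓜 s ψ → TruthStep U s ⇔ (¬ U ψ)
    step-neg {ψ} h = mk⇔ (read ∘ truthCase) (λ x → inj₂ (inj₁ (_ , h , x)))
      where
        read : TruthCase U s → ¬ U ψ
        read (eq-case _ _ k _) = clash (_ , h) (untag₂ k) λ ()
        read (mem-case _ _ k _) = clash (_ , h) (untag₂ k) λ ()
        read (or-case k _) = clash (_ , h) (untag₂ k) λ ()
        read (ex-case (_ , k) _) = clash (_ , h) (untag₂ k) λ ()
        read (neg-case k x) with Tagged-injective h k
        ... | _ , refl = x

    step-or : ∀ {ψ χ} → IsOr 𝓜 s ψ χ → TruthStep U s ⇔ (U ψ ⊎ U χ)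
    step-or {ψ} {χ} h = mk⇔ (read ∘ truthCase) (λ x → inj₂ (inj₂ (inj₁ (_ , _ , h , x))))
      where
        read : TruthCase U s → U ψ ⊎ U χ
        read (eq-case _ _ k _) = clash (untag₂ h) (untag₂ k) λ ()
        read (mem-case _ _ k _) = clash (untag₂ h) (untag₂ k) λ ()
        read (neg-case k _) = clash (untag₂ h) (_ , k) λ ()
        read (ex-case (_ , k) _) = clash (untag₂ h) (untag₂ k) λ ()
        read (or-case k x) with Tagged₂-injective h k
        ... | _ , refl , refl = x

    step-ex : ∀ {i ψ} → IsEx 𝓜 s i ψ →
              TruthStep U s ⇔ (∃[ x ] ∃[ r ] (Instance 𝓜 ψ i x r × U r))
    step-ex {i} {ψ} h = mk⇔ (read ∘ truthCase) (λ x → inj₂ (inj₂ (inj₂ (_ , _ , h , x))))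
      where
        read : TruthCase U s → ∃[ x ] ∃[ r ] (Instance 𝓜 ψ i x r × U r)
        read (eq-case _ _ k _) = clash (untag₂ (proj₂ h)) (untag₂ k) λ ()
        read (mem-case _ _ k _) = clash (untag₂ (proj₂ h)) (untag₂ k) λ ()
        read (neg-case k _) = clash (untag₂ (proj₂ h)) (_ , k) λ ()
        read (or-case k _) = clash (untag₂ (proj₂ h)) (untag₂ k) λ ()
        read (ex-case (_ , k) x) with Tagged₂-injective (proj₂ h) k
        ... | _ , refl , refl = x

  TruthStep-local : ∀ {U U′ s} → (∀ ψ → Immediate s ψ → U ψ ⇔ U′ ψ) →
                    TruthStep U s → TruthStep U′ s
  TruthStep-local f h with truthCase h
  ... | eq-case h k p x = from (step-eq h k p) x
  ... | mem-case h k p x = from (step-mem h k p) x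
  ... | neg-case p x = from (step-neg p) (x ∘ from (f _ (neg p)))
  ... | or-case p (inj₁ x) = from (step-or p) (inj₁ (to (f _ (orˡ p)) x))
  ... | or-case p (inj₂ x) = from (step-or p) (inj₂ (to (f _ (orʳ p)) x))
  ... | ex-case p (x , r , i , u) = from (step-ex p) (x , r , i , to (f _ (ex p i)) u)

  -- True (suc n) is the truth class for Depth_n.
  True : ℕ → Pred M ℓ
  True zero    s = ¬ (s ≡ s)
  True (suc n) s = Sentence≤ 𝓜 (num n) s × TruthStep (True n) s

  True∈𝔛 : ∀ n → True n ∈ 𝔛
  True∈𝔛 zero    = expressible∈𝔛 0 {Y = []} (¬ᵉ (≡ᵉ x0 x0)) [] _
  True∈𝔛 (suc n) = expressible∈𝔛 1 {Y = True n ∷ []}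
    (Sentence≤ᵉ x1 x0 ∧ᵉ TruthStepᵉ x0 x0) (True∈𝔛 n ∷ []) (num n , _)

  -- Consecutive stages consult only immediate subsentences, which have smaller depth and on which
  -- the stages agree by recursion; at depth 0 there are none. Hence `True (suc n)` obeys Tarski's
  -- clauses relative to itself and not just to the preceding stage.
  True-stable : ∀ n {s} → Sentence≤ 𝓜 (num n) s → True (suc n) s ⇔ True (suc (suc n)) s

  True-stable-immediate : ∀ n {s} → Sentence≤ 𝓜 (num n) s →
                          ∀ ψ → Immediate s ψ → True n ψ ⇔ True (suc n) ψ
  True-stable-immediate n sen ψ imm with immediate-Sentence≤ n sen imm
  ... | n′ , refl , sen′ = True-stable n′ sen′

  True-stable n sen = mk⇔
    (λ (_ , h) → Sentence≤-suc n sen , TruthStep-local (True-stable-immediate n sen) h)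
    (λ (_ , h) → sen , TruthStep-local (λ ψ i → ⇔-sym (True-stable-immediate n sen ψ i)) h)

  True-step : ∀ n {s} → Sentence≤ 𝓜 (num n) s → True (suc n) s ⇔ TruthStep (True (suc n)) s
  True-step n sen = mk⇔
    (λ (_ , h) → TruthStep-local (True-stable-immediate n sen) h)
    (λ h → sen , TruthStep-local (λ ψ i → ⇔-sym (True-stable-immediate n sen ψ i)) h)

  True-truthClass : ∀ n → IsDepthTruthClass 𝓜 (num n) (True (suc n))
  True-truthClass n = record
    { sentences  = proj₁
    ; eq-clause  = λ sen ta ub h → step-eq ta ub h ⇔-∘ True-step n sen
    ; mem-clause = λ sen ta ub h → step-mem ta ub h ⇔-∘ True-step n sen
    ; neg-clause = λ sen h → step-neg h ⇔-∘ True-step n sen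
    ; or-clause  = λ sen h → step-or h ⇔-∘ True-step n sen
    ; ex-clause  = λ sen h → step-ex h ⇔-∘ True-step n sen
    }

  Standard⊆C-Most : Standard 𝓜 ⊆ C-Most 𝓜 𝔛
  Standard⊆C-Most (n , h) with Numeral⇒≡ n h
  ... | refl = num-FiniteOrdinal n , True (suc n) , True∈𝔛 (suc n) , True-truthClass n

-- Standard formulas as elements of the model

module Syntax {ℓ ℓ′} (em : ExcludedMiddle ℓ) (𝓜 : SetStructure ℓ)
  (𝔛 : Pred (Pred (SetStructure.Carrier 𝓜) ℓ) ℓ′) (gb : IsGB₀ 𝓜 𝔛) where

  open SetStructure 𝓜 renaming (Carrier to M)
  open Expressibility em 𝓜
  open Sets em 𝓜 𝔛 gb
  open Coding em 𝓜 𝔛 gb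

  -- The code in 𝓜 of φ, its free variables being replaced by the terms ρ.  The
  -- variable bound in a context of length n is vₙ, so names are de Bruijn levels.
  encode : ∀ {n} → LZF n → Vec M n → M
  encode (i ≈̇ j)      ρ = tag₂ 2 (lookup ρ i) (lookup ρ j)
  encode (i ∈̇ j)      ρ = tag₂ 3 (lookup ρ i) (lookup ρ j)
  encode (¬̇ φ)        ρ = tag 4 (encode φ ρ)
  encode (φ ∨̇ ψ)      ρ = tag₂ 5 (encode φ ρ) (encode ψ ρ)
  encode {n} (∃̇ φ)    ρ = tag₂ 6 (num n) (encode φ (tag 0 (num n) ∷ ρ))

  vars : ∀ n → Vec M n
  vars zero    = []
  vars (suc n) = tag 0 (num n) ∷ vars n

  consts : ∀ {n} → Vec M n → Vec M n
  consts = Vec.map (tag 1)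

  assignment : ∀ {n} → Vec M n → M
  assignment []              = ∅
  assignment {suc n} (x ∷ v) = adjoin (assignment v) (opair (num n) x)

  num-IsVar : ∀ n → IsVar 𝓜 (tag 0 (num n)) (num n)
  num-IsVar n = num-FiniteOrdinal n , tag-Tagged 0 _

  IsEx-encode : ∀ n ψ → IsEx 𝓜 (tag₂ 6 (num n) ψ) (num n) ψ
  IsEx-encode n ψ = num-FiniteOrdinal n , tag₂-Tagged₂ 6 _ _

  formulaDepth : ∀ {n} → LZF n → ℕ
  formulaDepth (i ≈̇ j) = 0
  formulaDepth (i ∈̇ j) = 0
  formulaDepth (¬̇ φ)   = suc (formulaDepth φ)
  formulaDepth (φ ∨̇ ψ) = suc (formulaDepth φ ⊔ℕ formulaDepth ψ)
  formulaDepth (∃̇ φ)   = suc (formulaDepth φ)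

  num-IsMax : ∀ m n → IsMax 𝓜 (num (m ⊔ℕ n)) (num m) (num n)
  num-IsMax m n with ≤-total m n
  ... | inj₁ m≤n = inj₁ (num-≼ m≤n , cong num (m≤n⇒m⊔n≡n m≤n))
  ... | inj₂ n≤m = inj₂ (num-≼ n≤m , cong num (m≥n⇒m⊔n≡m n≤m))

  encode-depth : ∀ {n} (φ : LZF n) ρ → (∀ i → ∃[ j ] IsVar 𝓜 (lookup ρ i) j) →
                 Pairs.Derivable DepthStep (encode φ ρ , num (formulaDepth φ))
  encode-depth (i ≈̇ j) ρ h = Pairs.derive DepthStep-mono []
    (inj₁ ((_ , _ , h i , h j , inj₁ (tag₂-Tagged₂ 2 _ _)) , ∅-Empty))
  encode-depth (i ∈̇ j) ρ h = Pairs.derive DepthStep-mono []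
    (inj₁ ((_ , _ , h i , h j , inj₂ (tag₂-Tagged₂ 3 _ _)) , ∅-Empty))
  encode-depth (¬̇ φ) ρ h = Pairs.derive DepthStep-mono (encode-depth φ ρ h ∷ [])
    (inj₂ (inj₁ (_ , _ , tag-Tagged 4 _ , here refl , adjoin-Adjoin _ _)))
  encode-depth (φ ∨̇ ψ) ρ h = Pairs.derive DepthStep-mono
    (encode-depth φ ρ h ∷ encode-depth ψ ρ h ∷ [])
    (inj₂ (inj₂ (inj₁ (_ , _ , _ , _ , _ , tag₂-Tagged₂ 5 _ _ , here refl , there (here refl) ,
      num-IsMax (formulaDepth φ) (formulaDepth ψ) , adjoin-Adjoin _ _))))
  encode-depth {n} (∃̇ φ) ρ h = Pairs.derive DepthStep-mono
    (encode-depth φ _ (λ { zero → _ , num-IsVar n ; (suc i) → h i }) ∷ [])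
    (inj₂ (inj₂ (inj₂ (_ , _ , _ , IsEx-encode n _ , here refl , adjoin-Adjoin _ _))))

  TermSubst-functional : ∀ {α b t u u′} → IsFunction 𝓜 α →
    TermSubst 𝓜 α b t u → TermSubst 𝓜 α b t u′ → u ≡ u′
  TermSubst-functional f (inj₁ (_ , _ , _ , refl)) (inj₁ (_ , _ , _ , eq)) = sym eq
  TermSubst-functional f (inj₁ (_ , (_ , h) , i∈b , _)) (inj₂ (inj₁ (_ , _ , (_ , k) , i∉b , _)))
    with Tagged-injective h k
  ... | _ , refl = contradiction i∈b i∉b
  TermSubst-functional f (inj₁ (_ , (_ , h) , _)) (inj₂ (inj₂ (_ , k , _))) =
    clash (_ , h) (_ , k) λ ()
  TermSubst-functional f (inj₂ (inj₁ (_ , _ , (_ , h) , i∉b , _))) (inj₁ (_ , (_ , k) , i∈b , _))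
    with Tagged-injective h k
  ... | _ , refl = contradiction i∈b i∉b
  TermSubst-functional f (inj₂ (inj₁ (_ , _ , (_ , h) , _ , x , c)))
    (inj₂ (inj₁ (_ , _ , (_ , k) , _ , y , d))) with Tagged-injective h k
  ... | _ , refl with f _ _ _ x y
  ... | refl = trans (Tagged⇒≡ c) (sym (Tagged⇒≡ d))
  TermSubst-functional f (inj₂ (inj₁ (_ , _ , (_ , h) , _))) (inj₂ (inj₂ (_ , k , _))) =
    clash (_ , h) (_ , k) λ ()
  TermSubst-functional f (inj₂ (inj₂ (_ , h , _))) (inj₁ (_ , (_ , k) , _)) =
    clash (_ , h) (_ , k) λ ()
  TermSubst-functional f (inj₂ (inj₂ (_ , h , _))) (inj₂ (inj₁ (_ , _ , (_ , k) , _))) =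
    clash (_ , h) (_ , k) λ ()
  TermSubst-functional f (inj₂ (inj₂ (_ , _ , refl))) (inj₂ (inj₂ (_ , _ , eq))) = sym eq

  -- The bound on indices keeps t and u related when a quantifier binds vₙ.
  record TermSubst< (α b : M) (n : ℕ) (t u : M) : Set ℓ where
    field
      related : TermSubst 𝓜 α b t u
      bounded : ∀ {i} → IsVar 𝓜 t i → i ε num n
  open TermSubst<

  bound-variable : ∀ {α b} n →
    TermSubst< α (adjoin b (num n)) (suc n) (tag 0 (num n)) (tag 0 (num n))
  bound-variable n .related = inj₁ (_ , num-IsVar n , adjoin-∋ , refl)
  bound-variable n .bounded (_ , h) with Tagged-injective h (tag-Tagged 0 _)
  ... | _ , refl = adjoin-∋

  under-quantifier : ∀ {α b n t u} → TermSubst< α b n t u →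
                     TermSubst< α (adjoin b (num n)) (suc n) t u
  under-quantifier σ .bounded v = adjoin-⊇ (bounded σ v)
  under-quantifier σ .related with related σ
  ... | inj₁ (i , v , i∈b , eq) = inj₁ (i , v , adjoin-⊇ i∈b , eq)
  ... | inj₂ (inj₂ h) = inj₂ (inj₂ h)
  ... | inj₂ (inj₁ (i , a , v , i∉b , h)) =
    inj₂ (inj₁ (i , a , v , [ i∉b , (λ { refl → ε-irrefl _ (bounded σ v) }) ]′ ∘ adjoin-∈ , h))

  Substitutes : ∀ {n} → M → M → Vec M n → Vec M n → Set ℓ
  Substitutes {n} α b ρ ρ′ = ∀ i → TermSubst< α b n (lookup ρ i) (lookup ρ′ i)

  Substitutes-∷ : ∀ {α b n} {ρ ρ′ : Vec M n} → Substitutes α b ρ ρ′ →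
    Substitutes α (adjoin b (num n)) (tag 0 (num n) ∷ ρ) (tag 0 (num n) ∷ ρ′)
  Substitutes-∷ σ zero    = bound-variable _
  Substitutes-∷ σ (suc i) = under-quantifier (σ i)

  encode-subst : ∀ {α b n} (φ : LZF n) {ρ ρ′} → Substitutes α b ρ ρ′ →
                 Triples.Derivable (SubstStep α) (encode φ ρ , b , encode φ ρ′)
  encode-subst {α} (i ≈̇ j) σ = Triples.derive (SubstStep-mono α) []
    (inj₁ (_ , _ , _ , _ , related (σ i) , related (σ j) ,
      inj₁ (tag₂-Tagged₂ 2 _ _ , tag₂-Tagged₂ 2 _ _)))
  encode-subst {α} (i ∈̇ j) σ = Triples.derive (SubstStep-mono α) []
    (inj₁ (_ , _ , _ , _ , related (σ i) , related (σ j) ,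
      inj₂ (tag₂-Tagged₂ 3 _ _ , tag₂-Tagged₂ 3 _ _)))
  encode-subst {α} (¬̇ φ) σ = Triples.derive (SubstStep-mono α) (encode-subst φ σ ∷ [])
    (inj₂ (inj₁ (_ , _ , tag-Tagged 4 _ , tag-Tagged 4 _ , here refl)))
  encode-subst {α} (φ ∨̇ ψ) σ = Triples.derive (SubstStep-mono α)
    (encode-subst φ σ ∷ encode-subst ψ σ ∷ [])
    (inj₂ (inj₂ (inj₁ (_ , _ , _ , _ , tag₂-Tagged₂ 5 _ _ , tag₂-Tagged₂ 5 _ _ ,
      here refl , there (here refl)))))
  encode-subst {α} {n = n} (∃̇ φ) σ = Triples.derive (SubstStep-mono α)
    (encode-subst φ (Substitutes-∷ σ) ∷ [])
    (inj₂ (inj₂ (inj₂ (_ , _ , _ , _ , IsEx-encode n _ , IsEx-encode n _ ,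
      adjoin-Adjoin _ _ , here refl))))

  -- The certificate `g` may contain triples for nonstandard formulas. The recursion follows the
  -- external formula and inverts one step at a time, so it meets only triples for subformulas of
  -- `φ`.
  encode-subst-unique : ∀ {α g} → IsFunction 𝓜 α → SubstCertificate 𝓜 α g →
    ∀ {b n} (φ : LZF n) {ρ ρ′ s} → Substitutes α b ρ ρ′ →
    Triple∈ 𝓜 g (encode φ ρ) b s → s ≡ encode φ ρ′
  encode-subst-unique f C (i ≈̇ j) σ h with invert-eq (C _ _ _ h) (tag₂-Tagged₂ 2 _ _)
  ... | _ , _ , τ , τ′ , p = trans (Tagged₂⇒≡ p) (cong₂ (tag₂ 2)
    (TermSubst-functional f τ (related (σ i))) (TermSubst-functional f τ′ (related (σ j))))
  encode-subst-unique f C (i ∈̇ j) σ h with invert-mem (C _ _ _ h) (tag₂-Tagged₂ 3 _ _)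
  ... | _ , _ , τ , τ′ , p = trans (Tagged₂⇒≡ p) (cong₂ (tag₂ 3)
    (TermSubst-functional f τ (related (σ i))) (TermSubst-functional f τ′ (related (σ j))))
  encode-subst-unique f C (¬̇ φ) σ h with invert-neg (C _ _ _ h) (tag-Tagged 4 _)
  ... | _ , p , h′ = trans (Tagged⇒≡ p) (cong (tag 4) (encode-subst-unique f C φ σ h′))
  encode-subst-unique f C (φ ∨̇ ψ) σ h with invert-or (C _ _ _ h) (tag₂-Tagged₂ 5 _ _)
  ... | _ , _ , p , h₁ , h₂ = trans (Tagged₂⇒≡ p) (cong₂ (tag₂ 5)
    (encode-subst-unique f C φ σ h₁) (encode-subst-unique f C ψ σ h₂))
  encode-subst-unique f C {n = n} (∃̇ φ) σ h with invert-ex (C _ _ _ h) (IsEx-encode n _)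
  ... | _ , _ , (_ , p) , A , h′ with Adjoin⇒≡ A
  ... | refl = trans (Tagged₂⇒≡ p) (cong (tag₂ 6 _)
    (encode-subst-unique f C φ (Substitutes-∷ σ) h′))

  Subst-encode : ∀ {α n} (φ : LZF n) {ρ ρ′ s} → IsFunction 𝓜 α → Substitutes α ∅ ρ ρ′ →
                 Subst 𝓜 (encode φ ρ) α s ⇔ (s ≡ encode φ ρ′)
  Subst-encode φ f σ = mk⇔ unique (λ { refl → Derivable⇒Subst (encode-subst φ σ) })
    where
      unique : ∀ {s} → Subst 𝓜 (encode φ _) _ s → s ≡ encode φ _
      unique (g , e , e∅ , C , h) with Empty⇒≡ e∅
      ... | refl = encode-subst-unique f C φ σ h

  -- The index `num n` assigned next is therefore fresh, whence assignments are single-valued.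
  assignment-bounded : ∀ {n} (v : Vec M n) {j a} → Pair∈ 𝓜 (assignment v) j a → j ε num n
  assignment-bounded []      h = ⊥-elim (∅-Empty _ (Pair∈⇒opair∈ h))
  assignment-bounded (x ∷ v) h with adjoin-∈ (Pair∈⇒opair∈ h)
  ... | inj₁ h′ = adjoin-⊇ (assignment-bounded v (opair∈⇒Pair∈ h′))
  ... | inj₂ eq with opair-injective eq
  ... | refl , _ = adjoin-∋

  assignment-function : ∀ {n} (v : Vec M n) → IsFunction 𝓜 (assignment v)
  assignment-function []      i a b h k = ⊥-elim (∅-Empty _ (Pair∈⇒opair∈ h))
  assignment-function (x ∷ v) i a b h k
    with adjoin-∈ (Pair∈⇒opair∈ h) | adjoin-∈ (Pair∈⇒opair∈ k)
  ... | inj₁ h′ | inj₁ k′ = assignment-function v i a b (opair∈⇒Pair∈ h′) (opair∈⇒Pair∈ k′)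
  ... | inj₂ eq | inj₂ eq′ =
    trans (proj₂ (opair-injective eq)) (sym (proj₂ (opair-injective eq′)))
  ... | inj₁ h′ | inj₂ eq with opair-injective eq
  ... | refl , _ = ⊥-elim (ε-irrefl _ (assignment-bounded v (opair∈⇒Pair∈ h′)))
  assignment-function (x ∷ v) i a b h k | inj₂ eq | inj₁ k′ with opair-injective eq
  ... | refl , _ = ⊥-elim (ε-irrefl _ (assignment-bounded v (opair∈⇒Pair∈ k′)))

  -- The equation converts the index `i` into the level `l`: index 0 is the innermost variable and
  -- bears the largest name.
  lookup-vars : ∀ {n} (v : Vec M n) i → ∃[ l ] (lookup (vars n) i ≡ tag 0 (num l) ×
                suc (toℕ i + l) ≡ n × Pair∈ 𝓜 (assignment v) (num l) (lookup v i))
  lookup-vars {suc n} (x ∷ v) zero    = n , refl , refl , opair∈⇒Pair∈ adjoin-∋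
  lookup-vars {suc n} (x ∷ v) (suc i) with lookup-vars v i
  ... | l , eq , l<n , h = l , eq , cong suc l<n , opair∈⇒Pair∈ (adjoin-⊇ (Pair∈⇒opair∈ h))

  vars-IsVar : ∀ {n} (v : Vec M n) i → ∃[ j ] IsVar 𝓜 (lookup (vars n) i) j
  vars-IsVar v i with lookup-vars v i
  ... | l , eq , _ = num l , subst (λ t → IsVar 𝓜 t (num l)) (sym eq) (num-IsVar l)

  const-substitutes : ∀ {α b n a} → TermSubst< α b n (tag 1 a) (tag 1 a)
  const-substitutes .related = inj₂ (inj₂ (_ , tag-Tagged 1 _ , refl))
  const-substitutes .bounded (_ , k) = clash (_ , tag-Tagged 1 _) (_ , k) λ ()

  variable-substitutes : ∀ {α n l a} → l < n → Pair∈ 𝓜 α (num l) a →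
                         TermSubst< α ∅ n (tag 0 (num l)) (tag 1 a)
  variable-substitutes {l = l} l<n h .related =
    inj₂ (inj₁ (_ , _ , num-IsVar l , ∅-Empty _ , h , tag-Tagged 1 _))
  variable-substitutes l<n h .bounded (_ , k) with Tagged-injective k (tag-Tagged 0 _)
  ... | _ , refl = num-∈ l<n

  assignment-substitutes : ∀ {n} (v : Vec M n) → Substitutes (assignment v) ∅ (vars n) (consts v)
  assignment-substitutes v i with lookup-vars v i
  ... | l , eq , l<n , h rewrite eq | lookup-map i (tag 1) v =
    variable-substitutes (subst (l <_) l<n (s≤s (m≤n+m l (toℕ i)))) h

  instance-substitutes : ∀ {n} x (v : Vec M n) {p} → p ≡ opair (num n) x →
    Substitutes (upair p p) ∅ (tag 0 (num n) ∷ consts v) (consts (x ∷ v))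
  instance-substitutes x v refl zero    = variable-substitutes ≤-refl (opair∈⇒Pair∈ upair-∋ˡ)
  instance-substitutes x v refl (suc i) rewrite lookup-map i (tag 1) v = const-substitutes

  singleton-function : ∀ i x → IsFunction 𝓜 (upair (opair i x) (opair i x))
  singleton-function i x j a b h k = trans (value h) (sym (value k))
    where
      value : ∀ {a} → Pair∈ 𝓜 (upair (opair i x) (opair i x)) j a → a ≡ x
      value h = proj₂ (opair-injective ([ id , id ]′ (upair-∈ (Pair∈⇒opair∈ h))))

  Subst-assignment : ∀ {n} (φ : LZF n) v {s} →
    Subst 𝓜 (encode φ (vars n)) (assignment v) s ⇔ (s ≡ encode φ (consts v))
  Subst-assignment φ v = Subst-encode φ (assignment-function v) (assignment-substitutes v)

  Instance-encode : ∀ {n} (φ : LZF (suc n)) v {x s} →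
    Instance 𝓜 (encode φ (tag 0 (num n) ∷ consts v)) (num n) x s ⇔ (s ≡ encode φ (consts (x ∷ v)))
  Instance-encode {n} φ v {x} = mk⇔ unique λ { refl →
      _ , _ , opair-OPair _ _ , upair-UPair _ _ , from substitution refl }
    where
      substitution : ∀ {s} → Subst 𝓜 (encode φ (tag 0 (num n) ∷ consts v))
        (upair (opair (num n) x) (opair (num n) x)) s ⇔ (s ≡ encode φ (consts (x ∷ v)))
      substitution =
        Subst-encode φ (singleton-function (num n) x) (instance-substitutes x v refl)
      unique : ∀ {s} → Instance 𝓜 (encode φ (tag 0 (num n) ∷ consts v)) (num n) x s →
               s ≡ encode φ (consts (x ∷ v))
      unique (p , α , o , u , h) with OPair⇒≡ o
      ... | refl with UPair⇒≡ u
      ... | refl = to substitution h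

  -- Agreement with satisfaction, and Tarski's diagonal argument

  module Nonstandard {k} (k-fin : FiniteOrdinal 𝓜 k) (k-ns : ¬ Standard 𝓜 k)
    {T} (T∈𝔛 : T ∈ 𝔛) (T-truth : IsDepthTruthClass 𝓜 k T) where

    open IsDepthTruthClass T-truth

    encode-Sentence≤ : ∀ {n} (φ : LZF n) v → Sentence≤ 𝓜 k (encode φ (consts v))
    encode-Sentence≤ {n} φ v = encode φ (vars n) , assignment v ,
      (num (formulaDepth φ) , Derivable⇒HasDepth (encode-depth φ (vars n) (vars-IsVar v)) ,
       inj₁ (num∈ k-fin (formulaDepth φ) (inj₂ refl) k-ns)) ,
      assignment-function v , from (Subst-assignment φ v) refl

    lookup-IsConst : ∀ {n} (v : Vec M n) i → IsConst 𝓜 (lookup (consts v) i) (lookup v i)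
    lookup-IsConst v i rewrite lookup-map i (tag 1) v = tag-Tagged 1 _

    truth : ∀ {n} (φ : LZF n) v → (encode φ (consts v) ∈ T) ⇔ Sat 𝓜 φ [] v
    truth (i ≈̇ j) v = eq-clause (encode-Sentence≤ (i ≈̇ j) v)
      (lookup-IsConst v i) (lookup-IsConst v j) (tag₂-Tagged₂ 2 _ _)
    truth (i ∈̇ j) v = mem-clause (encode-Sentence≤ (i ∈̇ j) v)
      (lookup-IsConst v i) (lookup-IsConst v j) (tag₂-Tagged₂ 3 _ _)
    truth (¬̇ φ) v = mk⇔
      (λ h s → to clause h (from (truth φ v) s))
      (λ h → from clause (h ∘ to (truth φ v)))
      where clause = neg-clause (encode-Sentence≤ (¬̇ φ) v) (tag-Tagged 4 _)
    truth (φ ∨̇ ψ) v = mk⇔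
      (λ h → [ inj₁ ∘ to (truth φ v) , inj₂ ∘ to (truth ψ v) ]′ (to clause h))
      (λ h → from clause ([ inj₁ ∘ from (truth φ v) , inj₂ ∘ from (truth ψ v) ]′ h))
      where clause = or-clause (encode-Sentence≤ (φ ∨̇ ψ) v) (tag₂-Tagged₂ 5 _ _)
    truth {n} (∃̇ φ) v = mk⇔
      (λ h → witness (to clause h))
      (λ (x , s) → from clause
        (x , _ , from (Instance-encode φ v) refl , from (truth φ (x ∷ v)) s))
      where
        clause = ex-clause (encode-Sentence≤ (∃̇ φ) v) (IsEx-encode n _)
        witness : ∃[ x ] ∃[ r ] (Instance 𝓜 (encode φ (tag 0 (num n) ∷ consts v)) (num n) x r ×
                  r ∈ T) → ∃[ x ] Sat 𝓜 φ [] (x ∷ v)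
        witness (x , r , h , r∈T) with to (Instance-encode φ v) h
        ... | refl = x , to (truth φ (x ∷ v)) r∈T

    -- x = ⟨φ, ⟨m, w⟩⟩, where w assigns values to the variables below m, does not satisfy
    -- φ when it is itself assigned to vₘ.
    Diagonal : Pred M ℓ
    Diagonal x = ∃[ φ ] ∃[ q ] ∃[ m ] ∃[ w ] ∃[ p ] ∃[ α ] ∃[ s ]
      (OPair 𝓜 x φ q × OPair 𝓜 q m w × OPair 𝓜 p m x × Adjoin 𝓜 α w p ×
       Subst 𝓜 φ α s × ¬ (s ∈ T))

    decompose : ∀ {x φ q m w p α φ₀ m₀ w₀} → OPair 𝓜 x φ q → OPair 𝓜 q m w → OPair 𝓜 p m x →
      Adjoin 𝓜 α w p → x ≡ opair φ₀ (opair m₀ w₀) → φ ≡ φ₀ × α ≡ adjoin w₀ (opair m₀ x)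
    decompose o₁ o₂ o₃ A eq with opair-injective (trans (sym (OPair⇒≡ o₁)) eq)
    ... | refl , q≡ with opair-injective (trans (sym (OPair⇒≡ o₂)) q≡)
    ... | refl , refl with OPair⇒≡ o₃
    ... | refl = refl , Adjoin⇒≡ A

    Diagonal∈𝔛 : Diagonal ∈ 𝔛
    Diagonal∈𝔛 = expressible∈𝔛 0 {Y = T ∷ []}
      (∃ᵉ (∃ᵉ (∃ᵉ (∃ᵉ (∃ᵉ (∃ᵉ (∃ᵉ (OPairᵉ x7 x6 x5 ∧ᵉ OPairᵉ x5 x4 x3 ∧ᵉ OPairᵉ x2 x4 x7 ∧ᵉ
        Adjoinᵉ x1 x3 x2 ∧ᵉ Substᵉ x6 x1 x0 ∧ᵉ ¬ᵉ (classᵉ x0 x0))))))))) (T∈𝔛 ∷ []) _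

    Diagonal-undefinable : ¬ (Diagonal ∈ Definable 𝓜)
    Diagonal-undefinable (n , φ , v , D⊆ , ⊆D) = ¬D (⊆D (to (truth φ (d ∷ v)) (em⇒dne em λ ∉T →
        ¬D (_ , _ , _ , _ , _ , _ , _ , opair-OPair _ _ , opair-OPair _ _ , opair-OPair _ _ ,
            adjoin-Adjoin _ _ , from (Subst-assignment φ (d ∷ v)) refl , ∉T))))
      where
        d : M
        -- The level `num n` names variable 0 of `φ`, which stands for the element of the class, and
        -- `assignment v` carries the parameters. Adjoining `⟨n, d⟩` thus produces exactly
        -- `assignment (d ∷ v)`.
        d = opair (encode φ (vars (suc n))) (opair (num n) (assignment v))
        ¬D : ¬ Diagonal d
        ¬D D@(φ′ , q , m , w , p , α , s , o₁ , o₂ , o₃ , A , σ , s∉T)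
          with decompose o₁ o₂ o₃ A refl
        ... | refl , refl = s∉T (subst (_∈ T) (sym (to (Subst-assignment φ (d ∷ v)) σ))
                                       (from (truth φ (d ∷ v)) (D⊆ D)))

-- Cantor's pairing as a recursive function

addᴿ : Rec 2
addᴿ = precᴿ (projᴿ zero) (compᴿ sucᴿ (projᴿ (suc zero) ∷ []))

triangleᴿ : Rec 1
triangleᴿ = precᴿ zeroᴿ (compᴿ addᴿ (compᴿ sucᴿ (projᴿ zero ∷ []) ∷ projᴿ (suc zero) ∷ []))

pairᴿ : Rec 2
pairᴿ = compᴿ addᴿ
  (compᴿ triangleᴿ (compᴿ addᴿ (projᴿ zero ∷ projᴿ (suc zero) ∷ []) ∷ []) ∷ projᴿ (suc zero) ∷ [])

addᴿ⇓ : ∀ a b → addᴿ [ a ∷ b ∷ [] ]⇓ a + b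
addᴿ⇓ zero    b = prec-zero⇓ proj⇓
addᴿ⇓ (suc a) b = prec-suc⇓ (addᴿ⇓ a b) (comp⇓ (proj⇓ ∷ []) suc⇓)

triangleᴿ⇓ : ∀ n → triangleᴿ [ n ∷ [] ]⇓ triangle n
triangleᴿ⇓ zero    = prec-zero⇓ zero⇓
triangleᴿ⇓ (suc n) =
  prec-suc⇓ (triangleᴿ⇓ n) (comp⇓ (comp⇓ (proj⇓ ∷ []) suc⇓ ∷ proj⇓ ∷ []) (addᴿ⇓ (suc n) _))

pairᴿ⇓ : ∀ a b → pairᴿ [ a ∷ b ∷ [] ]⇓ pair a b
pairᴿ⇓ a b = comp⇓
  (comp⇓ (comp⇓ (proj⇓ ∷ proj⇓ ∷ []) (addᴿ⇓ a b) ∷ []) (triangleᴿ⇓ (a + b)) ∷ proj⇓ ∷ [])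
  (addᴿ⇓ (triangle (a + b)) b)

triangle-≥ : ∀ n → n ≤ triangle n
triangle-≥ zero    = z≤n
triangle-≥ (suc n) = m≤m+n (suc n) (triangle n)

triangle-mono-≤ : ∀ {m n} → m ≤ n → triangle m ≤ triangle n
triangle-mono-≤ z≤n       = z≤n
triangle-mono-≤ (s≤s m≤n) = +-mono-≤ (s≤s m≤n) (triangle-mono-≤ m≤n)

pair-≥ˡ : ∀ a b → a ≤ pair a b
pair-≥ˡ a b = ≤-trans (m≤m+n a b) (≤-trans (triangle-≥ (a + b)) (m≤m+n _ b))

pair-≥ʳ : ∀ a b → b ≤ pair a b
pair-≥ʳ a b = m≤n+m b (triangle (a + b))

-- Pairs with sum `s` have codes from `triangle s` to below `triangle (suc s)`, because the offset
-- is at most `s`. Blocks for different sums are therefore disjoint and ordered by the sum.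
pair-<-diagonal : ∀ a b c d → a + b < c + d → pair a b < pair c d
pair-<-diagonal a b c d lt = begin-strict
  triangle (a + b) + b        ≡⟨ +-comm (triangle (a + b)) b ⟩
  b + triangle (a + b)        ≤⟨ +-monoˡ-≤ _ (m≤n+m b a) ⟩
  a + b + triangle (a + b)    <⟨ ≤-refl ⟩
  triangle (suc (a + b))      ≤⟨ triangle-mono-≤ lt ⟩
  triangle (c + d)            ≤⟨ m≤m+n _ d ⟩
  triangle (c + d) + d        ∎
  where open ≤-Reasoning

pair-injective : ∀ a b c d → pair a b ≡ pair c d → a ≡ c × b ≡ d
pair-injective a b c d eq with <-cmp (a + b) (c + d)
... | tri< lt _ _ = contradiction eq (<⇒≢ (pair-<-diagonal a b c d lt))
... | tri> _ _ gt = contradiction (sym eq) (<⇒≢ (pair-<-diagonal c d a b gt))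
... | tri≈ _ s _  = +-cancelʳ-≡ d a c (trans (cong (a +_) (sym b≡d)) s) , b≡d
  where
    b≡d : b ≡ d
    b≡d = +-cancelˡ-≡ (triangle (c + d)) b d (subst (λ s → triangle s + b ≡ pair c d) s eq)

-- Representing recursive functions in the model

module Representation {ℓ ℓ′} (em : ExcludedMiddle ℓ) (𝓜 : SetStructure ℓ)
  (𝔛 : Pred (Pred (SetStructure.Carrier 𝓜) ℓ) ℓ′) (gb : IsGB₀ 𝓜 𝔛) where

  open SetStructure 𝓜 renaming (Carrier to M)
  open Expressibility em 𝓜
  open Sets em 𝓜 𝔛 gb
  open Coding em 𝓜 𝔛 gb

  tuple : ∀ {n} → Vec ℕ n → M
  tuple []       = ∅
  tuple (x ∷ xs) = opair (num x) (tuple xs)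

  Entry : ∀ {n} → Fin n → M → M → Set ℓ
  Entry zero    xs y = ∃[ t ] OPair 𝓜 xs y t
  Entry (suc i) xs y = ∃[ x ] ∃[ t ] (OPair 𝓜 xs x t × Entry i t y)

  -- Rule for an entry ⟨argument, value⟩ in the history of a primitive recursion. A set of entries
  -- justified by it does the work of Gödel's β-function.
  PrecStep : (M → M → Set ℓ) → (M → M → Set ℓ) → M → (M × M → Set ℓ) → M × M → Set ℓ
  PrecStep F G t R (i , z) =
      (Empty 𝓜 i × F t z)
    ⊎ (∃[ j ] ∃[ y ] ∃[ u ] ∃[ w ]
         (Succ 𝓜 i j × R (j , y) × OPair 𝓜 u y t × OPair 𝓜 w j u × G w z))

  -- With this condition a possibly nonstandard value of a minimisation can be
  -- compared with a standard one by an external induction.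
  ClosedBelow : M → Set ℓ
  ClosedBelow k = ∀ i → (Empty 𝓜 i → _≼_ 𝓜 i k) ×
                        (i ε k → ∀ j → Succ 𝓜 j i → _≼_ 𝓜 j k)

  -- `Graph f` is controlled only at standard arguments where `f` converges, by `Graph-complete` and
  -- `Graph-unique`. This is enough for a characteristic function, which converges at every natural
  -- number.
  Graph  : ∀ {n} → Rec n → M → M → Set ℓ
  Graphs : ∀ {m n} → Vec (Rec n) m → M → M → Set ℓ
  Graph zeroᴿ        xs y = Empty 𝓜 y
  Graph sucᴿ         xs y = ∃[ x ] ∃[ t ] (OPair 𝓜 xs x t × Succ 𝓜 y x)
  Graph (projᴿ i)    xs y = Entry i xs y
  Graph (compᴿ f gs) xs y = ∃[ ys ] (Graphs gs xs ys × Graph f ys y)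
  Graph (precᴿ f g)  xs y = ∃[ k ] ∃[ t ] ∃[ h ] (OPair 𝓜 xs k t ×
    (∀ i z → Pair∈ 𝓜 h i z →
       PrecStep (Graph f) (Graph g) t (λ (j , y) → Pair∈ 𝓜 h j y) (i , z)) ×
    Pair∈ 𝓜 h k y)
  Graph (minᴿ f)     xs k = ClosedBelow k ×
    (∃[ t ] ∃[ z ] (OPair 𝓜 t k xs × Empty 𝓜 z × Graph f t z)) ×
    (∀ i → i ε k → ∃[ t ] ∃[ z ] ∃[ y ] (OPair 𝓜 t i xs × Succ 𝓜 z y × Graph f t z))
  Graphs []       xs ys = Empty 𝓜 ys
  Graphs (g ∷ gs) xs ys = ∃[ y ] ∃[ t ] (OPair 𝓜 ys y t × Graph g xs y × Graphs gs xs t)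

  Entry-tuple : ∀ {n} (i : Fin n) xs → Entry i (tuple xs) (num (lookup xs i))
  Entry-tuple zero    (x ∷ xs) = _ , opair-OPair _ _
  Entry-tuple (suc i) (x ∷ xs) = _ , _ , opair-OPair _ _ , Entry-tuple i xs

  Entry-unique : ∀ {n} (i : Fin n) xs {z} → Entry i (tuple xs) z → z ≡ num (lookup xs i)
  Entry-unique zero    (x ∷ xs) (_ , o) = proj₁ (OPair-injective o (opair-OPair _ _))
  Entry-unique (suc i) (x ∷ xs) (_ , _ , o , h) with OPair-injective o (opair-OPair _ _)
  ... | _ , refl = Entry-unique i xs h

  PrecStep-mono : ∀ {F G t} {R S : M × M → Set ℓ} → (∀ i → R i → S i) →
                  ∀ i → PrecStep F G t R i → PrecStep F G t S i
  PrecStep-mono f _ (inj₁ h) = inj₁ h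
  PrecStep-mono f _ (inj₂ (j , y , u , w , s , r , h)) = inj₂ (j , y , u , w , s , f _ r , h)

  num-ClosedBelow : ∀ k → ClosedBelow (num k)
  num-ClosedBelow k i .proj₁ e rewrite Empty⇒≡ e = num-≼ {k} {0} z≤n
  num-ClosedBelow k i .proj₂ i∈k j s with ∈num k i∈k
  ... | i , i<k , refl with Adjoin⇒≡ s
  ... | refl = num-≼ i<k

  ClosedBelow-compare : ∀ {z} → ClosedBelow z → ∀ k →
                        (∃[ j ] (j < k × z ≡ num j)) ⊎ (_≼_ 𝓜 (num k) z)
  ClosedBelow-compare c zero    = inj₂ (proj₁ (c _) ∅-Empty)
  ClosedBelow-compare c (suc k) with ClosedBelow-compare c k
  ... | inj₁ (j , j<k , eq) = inj₁ (j , m<n⇒m<1+n j<k , eq)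
  ... | inj₂ (inj₁ k∈z)     = inj₂ (proj₂ (c _) k∈z _ (adjoin-Adjoin _ _))
  ... | inj₂ (inj₂ refl)    = inj₁ (k , ≤-refl , refl)

  Graph-complete  : ∀ {n} {f : Rec n} {xs y} → f [ xs ]⇓ y → Graph f (tuple xs) (num y)
  Graphs-complete : ∀ {m n} {gs : Vec (Rec n) m} {xs ys} →
                    Pointwise (λ g z → g [ xs ]⇓ z) gs ys → Graphs gs (tuple xs) (tuple ys)
  -- Taking the value and its derivation as one argument lets `below j j<k` be passed whole, so that
  -- the recursive call is visibly on a part of the given evaluation. `Graph-nonzero` has this form
  -- for the same reason.
  Graph-positive  : ∀ {n} {f : Rec n} {xs} → ∃[ y ] f [ xs ]⇓ suc y →
                    ∃[ y ] Graph f (tuple xs) (num (suc y))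
  Graph-complete zero⇓ = ∅-Empty
  Graph-complete suc⇓  = _ , _ , opair-OPair _ _ , adjoin-Adjoin _ _
  Graph-complete (proj⇓ {i = i} {xs}) = Entry-tuple i xs
  Graph-complete (comp⇓ ds d) = _ , Graphs-complete ds , Graph-complete d
  Graph-complete (prec-zero⇓ {f = f} {g} d)
    with Pairs.derive (PrecStep-mono {Graph f} {Graph g}) [] (inj₁ (∅-Empty , Graph-complete d))
  ... | h , cert , top = _ , _ , h , opair-OPair _ _ , (λ i z → cert (i , z)) , top
  Graph-complete (prec-suc⇓ {f = f} {g} {xs = xs} {k = k} {y} {z} d e) = extend (Graph-complete d)
    where
      extend : Graph (precᴿ f g) (tuple (k ∷ xs)) (num y) →
               Graph (precᴿ f g) (tuple (suc k ∷ xs)) (num z)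
      extend (_ , _ , h , o , cert , top) with OPair-injective o (opair-OPair _ _)
      ... | refl , refl
        with Pairs.derive (PrecStep-mono {Graph f} {Graph g} {tuple xs})
               ((h , (λ i → cert _ _) , top) ∷ [])
               (inj₂ (num k , num y , _ , _ , adjoin-Adjoin _ _ , here refl ,
                 opair-OPair _ _ , opair-OPair _ _ , Graph-complete e))
      ... | h′ , cert′ , top′ = _ , _ , h′ , opair-OPair _ _ , (λ i z → cert′ (i , z)) , top′
  Graph-complete (min⇓ {f = f} {xs} {k} d below) = num-ClosedBelow k ,
    (_ , _ , opair-OPair _ _ , ∅-Empty , Graph-complete d) , positive
    where
      positive : ∀ i → i ε num k → ∃[ t ] ∃[ z ] ∃[ y ]
                   (OPair 𝓜 t i (tuple xs) × Succ 𝓜 z y × Graph f t z)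
      positive i i∈k with ∈num k i∈k
      ... | j , j<k , refl with Graph-positive (below j j<k)
      ... | y , h = _ , _ , _ , opair-OPair _ _ , adjoin-Adjoin _ _ , h
  Graphs-complete []       = ∅-Empty
  Graphs-complete (d ∷ ds) = _ , _ , opair-OPair _ _ , Graph-complete d , Graphs-complete ds
  Graph-positive (y , d) = y , Graph-complete d

  num-suc-nonempty : ∀ n → ¬ Empty 𝓜 (num (suc n))
  num-suc-nonempty n e = e (num n) adjoin-∋

  Succ-num-suc : ∀ k {j} → Succ 𝓜 (num (suc k)) j → j ≡ num k
  Succ-num-suc k {j} s with ∈num (suc k) (from (s j) (inj₂ refl))
  ... | i , _ , refl = cong num (suc-injective (sym (num-injective {suc k} {suc i} (Adjoin⇒≡ s))))

  -- The value `z`, intermediate results and histories are arbitrary elements of `𝓜`. Induction on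
  -- the evaluation identifies whatever it consults as standard and ignores the rest.
  Graph-unique  : ∀ {n} {f : Rec n} {xs y} → f [ xs ]⇓ y →
                  ∀ {z} → Graph f (tuple xs) z → z ≡ num y
  Graphs-unique : ∀ {m n} {gs : Vec (Rec n) m} {xs ys} →
                  Pointwise (λ g z → g [ xs ]⇓ z) gs ys →
                  ∀ {zs} → Graphs gs (tuple xs) zs → zs ≡ tuple ys
  Graph-nonzero : ∀ {n} {f : Rec n} {xs} → ∃[ y ] f [ xs ]⇓ suc y →
                  ¬ (∃[ z ] (Empty 𝓜 z × Graph f (tuple xs) z))
  Graph-unique zero⇓ h = Empty⇒≡ h
  Graph-unique suc⇓ (_ , _ , o , s) with OPair-injective o (opair-OPair _ _)
  ... | refl , _ = Adjoin⇒≡ s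
  Graph-unique (proj⇓ {i = i} {xs}) h = Entry-unique i xs h
  Graph-unique (comp⇓ ds d) (_ , hs , h) with Graphs-unique ds hs
  ... | refl = Graph-unique d h
  Graph-unique (prec-zero⇓ d) (_ , _ , _ , o , cert , top)
    with OPair-injective o (opair-OPair _ _)
  ... | refl , refl with cert _ _ top
  ... | inj₁ (_ , h) = Graph-unique d h
  ... | inj₂ (_ , _ , _ , _ , s , _) = ⊥-elim (∅-Empty _ (from (s _) (inj₂ refl)))
  Graph-unique (prec-suc⇓ {k = k} d e) (_ , _ , h , o , cert , top)
    with OPair-injective o (opair-OPair _ _)
  ... | refl , refl with cert _ _ top
  ... | inj₁ (emp , _) = ⊥-elim (num-suc-nonempty k emp)
  ... | inj₂ (_ , _ , _ , _ , s , r , o₁ , o₂ , x) with Succ-num-suc k s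
  -- The history `h` of the longer recursion also serves for the shorter one, so the induction
  -- hypothesis determines the preceding value.
  ... | refl with Graph-unique d (_ , _ , h , opair-OPair _ _ , cert , r)
  ... | refl with OPair⇒≡ o₁
  ... | refl with OPair⇒≡ o₂
  ... | refl = Graph-unique e x
  -- A candidate smaller than `k` would give `f` the value zero where it is positive; a candidate
  -- above `k` would require `f` to be positive at `k`, where it is zero.
  Graph-unique (min⇓ {k = k} d below) (c , (t , z , o , emp , x) , pos)
    with ClosedBelow-compare c k
  ... | inj₂ (inj₂ eq) = sym eq
  ... | inj₁ (j , j<k , refl) with OPair⇒≡ o
  ... | refl = ⊥-elim (Graph-nonzero (below j j<k) (z , emp , x))
  Graph-unique (min⇓ {k = k} d below) (c , _ , pos) | inj₂ (inj₁ k∈z) with pos _ k∈z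
  ... | _ , _ , y , o , s , x with OPair⇒≡ o
  ... | refl with Graph-unique d x
  ... | refl = ⊥-elim (∅-Empty _ (from (s y) (inj₂ refl)))
  Graphs-unique []       h = Empty⇒≡ h
  Graphs-unique (d ∷ ds) (_ , _ , o , h , hs) with Graph-unique d h | Graphs-unique ds hs
  ... | refl | refl = OPair⇒≡ o
  Graph-nonzero (y , d) (z , emp , h) with Graph-unique d h
  ... | refl = num-suc-nonempty y emp

  module _ {c} {Y : Vec (Pred M ℓ) c} where

    Entryᵉ : ∀ {m n} (i : Fin m) (xs y : Fin n) → Expressible Y (λ e → Entry i (e ! xs) (e ! y))
    Entryᵉ zero    xs y = ∃ᵉ (OPairᵉ (1 ↑ʳ xs) (1 ↑ʳ y) x0)
    Entryᵉ (suc i) xs y = ∃ᵉ (∃ᵉ (OPairᵉ (2 ↑ʳ xs) x1 x0 ∧ᵉ Entryᵉ i x0 (2 ↑ʳ y)))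

    Graphᵉ  : ∀ {m n} (f : Rec m) (xs y : Fin n) →
              Expressible Y (λ e → Graph f (e ! xs) (e ! y))
    Graphsᵉ : ∀ {l m n} (gs : Vec (Rec m) l) (xs y : Fin n) →
              Expressible Y (λ e → Graphs gs (e ! xs) (e ! y))
    Graphᵉ zeroᴿ        xs y = Emptyᵉ y
    Graphᵉ sucᴿ         xs y = ∃ᵉ (∃ᵉ (OPairᵉ (2 ↑ʳ xs) x1 x0 ∧ᵉ Succᵉ (2 ↑ʳ y) x1))
    Graphᵉ (projᴿ i)    xs y = Entryᵉ i xs y
    Graphᵉ (compᴿ f gs) xs y = ∃ᵉ (Graphsᵉ gs (1 ↑ʳ xs) x0 ∧ᵉ Graphᵉ f x0 (1 ↑ʳ y))
    Graphᵉ (precᴿ f g)  xs y = ∃ᵉ (∃ᵉ (∃ᵉ (OPairᵉ (3 ↑ʳ xs) x2 x1 ∧ᵉ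
      ∀ᵉ (∀ᵉ (Pair∈ᵉ x2 x1 x0 ⇒ᵉ
           (Emptyᵉ x1 ∧ᵉ Graphᵉ f x3 x0)
        ∨ᵉ ∃ᵉ (∃ᵉ (∃ᵉ (∃ᵉ (Succᵉ x5 x3 ∧ᵉ Pair∈ᵉ x6 x3 x2 ∧ᵉ OPairᵉ x1 x2 x7 ∧ᵉ
                           OPairᵉ x0 x3 x1 ∧ᵉ Graphᵉ g x0 x4)))))) ∧ᵉ
      Pair∈ᵉ x0 x2 (3 ↑ʳ y))))
    Graphᵉ (minᴿ f)     xs k =
      ∀ᵉ ((Emptyᵉ x0 ⇒ᵉ ≼ᵉ x0 (1 ↑ʳ k)) ∧ᵉ
          (εᵉ x0 (1 ↑ʳ k) ⇒ᵉ ∀ᵉ (Succᵉ x0 x1 ⇒ᵉ ≼ᵉ x0 (2 ↑ʳ k)))) ∧ᵉ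
      ∃ᵉ (∃ᵉ (OPairᵉ x1 (2 ↑ʳ k) (2 ↑ʳ xs) ∧ᵉ Emptyᵉ x0 ∧ᵉ Graphᵉ f x1 x0)) ∧ᵉ
      ∀ᵉ (εᵉ x0 (1 ↑ʳ k) ⇒ᵉ
        ∃ᵉ (∃ᵉ (∃ᵉ (OPairᵉ x2 x3 (4 ↑ʳ xs) ∧ᵉ Succᵉ x1 x0 ∧ᵉ Graphᵉ f x2 x1))))
    Graphsᵉ []       xs ys = Emptyᵉ ys
    Graphsᵉ (g ∷ gs) xs ys = ∃ᵉ (∃ᵉ (OPairᵉ (2 ↑ʳ ys) x1 x0 ∧ᵉ
      Graphᵉ g (2 ↑ʳ xs) x1 ∧ᵉ Graphsᵉ gs (2 ↑ʳ xs) x0))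

-- Internal decoding of numerical codes of formulas

module Decoding {ℓ ℓ′} (em : ExcludedMiddle ℓ) (𝓜 : SetStructure ℓ)
  (𝔛 : Pred (Pred (SetStructure.Carrier 𝓜) ℓ) ℓ′) (gb : IsGB₀ 𝓜 𝔛) where

  open SetStructure 𝓜 renaming (Carrier to M)
  open Expressibility em 𝓜
  open Sets em 𝓜 𝔛 gb
  open Coding em 𝓜 𝔛 gb
  open Syntax em 𝓜 𝔛 gb
  open Representation em 𝓜 𝔛 gb

  Value₁ : Rec 1 → M → M → Set ℓ
  Value₁ f a y = ∃[ t ] ∃[ o ] (OPair 𝓜 t a o × Empty 𝓜 o × Graph f t y)

  Value₂ : Rec 2 → M → M → M → Set ℓ
  Value₂ f a b y = ∃[ t ] ∃[ u ] ∃[ o ]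
    (OPair 𝓜 t a u × OPair 𝓜 u b o × Empty 𝓜 o × Graph f t y)

  Value₁-num : ∀ {f a c} → f [ a ∷ [] ]⇓ c → ∀ {y} → Value₁ f (num a) y ⇔ (y ≡ num c)
  Value₁-num {f} {a} {c} d = mk⇔ unique
      λ { refl → _ , _ , opair-OPair _ _ , ∅-Empty , Graph-complete d }
    where
      unique : ∀ {y} → Value₁ f (num a) y → y ≡ num c
      unique (_ , _ , h , e , x) with Empty⇒≡ e
      ... | refl with OPair⇒≡ h
      ... | refl = Graph-unique d x

  Value₂-num : ∀ {f a b c} → f [ a ∷ b ∷ [] ]⇓ c →
               ∀ {y} → Value₂ f (num a) (num b) y ⇔ (y ≡ num c)
  Value₂-num {f} {a} {b} {c} d = mk⇔ unique
      λ { refl → _ , _ , _ , opair-OPair _ _ , opair-OPair _ _ , ∅-Empty , Graph-complete d }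
    where
      unique : ∀ {y} → Value₂ f (num a) (num b) y → y ≡ num c
      unique (_ , _ , _ , h , k , e , x) with Empty⇒≡ e
      ... | refl with OPair⇒≡ k
      ... | refl with OPair⇒≡ h
      ... | refl = Graph-unique d x

  -- The bounds ensure that a standard number only decodes to standard ones.
  PairOf : M → M → M → Set ℓ
  PairOf m a b = _≼_ 𝓜 a m × _≼_ 𝓜 b m × Value₂ pairᴿ a b m

  HeadOf : ℕ → M → M → Set ℓ
  HeadOf k m c = ∃[ z ] (Numeral 𝓜 k z × PairOf m z c)

  -- l is the level of the de Bruijn index i in a context of length n.
  LevelOf : M → M → M → Set ℓ
  LevelOf n i l = l ε n × ∃[ n′ ] (Succ 𝓜 n n′ × Value₂ addᴿ i l n′)

  PairOf-num : ∀ a b {m} → m ≡ pair a b → PairOf (num m) (num a) (num b)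
  PairOf-num a b refl =
    num-≼ (pair-≥ˡ a b) , num-≼ (pair-≥ʳ a b) , from (Value₂-num (pairᴿ⇓ a b)) refl

  PairOf⇒≡ : ∀ m {x y} → PairOf (num m) x y →
             ∃[ a ] ∃[ b ] (m ≡ pair a b × x ≡ num a × y ≡ num b)
  PairOf⇒≡ m (x≼m , y≼m , v) with ≼num m x≼m | ≼num m y≼m
  ... | a , _ , refl | b , _ , refl =
    a , b , num-injective (to (Value₂-num (pairᴿ⇓ a b)) v) , refl , refl

  HeadOf-num : ∀ k c {m} → m ≡ pair k c → HeadOf k (num m) (num c)
  HeadOf-num k c eq = num k , num-Numeral k , PairOf-num k c eq

  HeadOf⇒≡ : ∀ k m {x} → HeadOf k (num m) x → ∃[ c ] (m ≡ pair k c × x ≡ num c)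
  HeadOf⇒≡ k m (z , h , p) with PairOf⇒≡ m p
  ... | a , c , eq , refl , x≡ with num-injective {a} {k} (Numeral⇒≡ k h)
  ... | refl = c , eq , x≡

  LevelOf-num : ∀ i l {n} → suc (i + l) ≡ n → LevelOf (num n) (num i) (num l)
  LevelOf-num i l refl = num-∈ (s≤s (m≤n+m l i)) , num (i + l) , adjoin-Adjoin _ _ ,
    from (Value₂-num (addᴿ⇓ i l)) refl

  LevelOf⇒≡ : ∀ n i {y} → LevelOf (num n) (num i) y → ∃[ l ] (suc (i + l) ≡ n × y ≡ num l)
  LevelOf⇒≡ n i (y∈n , n′ , s , v) with ∈num n y∈n
  ... | l , _ , refl with to (Value₂-num (addᴿ⇓ i l)) v
  ... | refl = l , num-injective {suc (i + l)} {n} (sym (Adjoin⇒≡ s)) , refl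

  -- m is the numerical code of φ, and n the length of the context of φ.
  DecodeStep : (M × M × M → Set ℓ) → M × M × M → Set ℓ
  DecodeStep R (m , n , φ) =
      (∃[ c ] ∃[ i ] ∃[ j ] ∃[ l ] ∃[ l′ ] ∃[ t ] ∃[ u ]
         (PairOf c i j × LevelOf n i l × LevelOf n j l′ × Tagged 𝓜 0 t l × Tagged 𝓜 0 u l′ ×
          ((HeadOf 0 m c × IsEq 𝓜 φ t u) ⊎ (HeadOf 1 m c × IsMem 𝓜 φ t u))))
    ⊎ (∃[ c ] ∃[ ψ ] (HeadOf 2 m c × R (c , n , ψ) × IsNeg 𝓜 φ ψ))
    ⊎ (∃[ c ] ∃[ a ] ∃[ b ] ∃[ ψ ] ∃[ χ ]
         (HeadOf 3 m c × PairOf c a b × R (a , n , ψ) × R (b , n , χ) × IsOr 𝓜 φ ψ χ))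
    ⊎ (∃[ c ] ∃[ n′ ] ∃[ ψ ]
         (HeadOf 4 m c × Succ 𝓜 n′ n × R (c , n′ , ψ) × Tagged₂ 𝓜 6 φ n ψ))

  DecodeStep-mono : ∀ {R S : M × M × M → Set ℓ} → (∀ i → R i → S i) →
                    ∀ i → DecodeStep R i → DecodeStep S i
  DecodeStep-mono f _ (inj₁ h) = inj₁ h
  DecodeStep-mono f _ (inj₂ (inj₁ (c , ψ , h , r , k))) = inj₂ (inj₁ (c , ψ , h , f _ r , k))
  DecodeStep-mono f _ (inj₂ (inj₂ (inj₁ (c , a , b , ψ , χ , h , p , r , r′ , k)))) =
    inj₂ (inj₂ (inj₁ (c , a , b , ψ , χ , h , p , f _ r , f _ r′ , k)))
  DecodeStep-mono f _ (inj₂ (inj₂ (inj₂ (c , n′ , ψ , h , s , r , k)))) =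
    inj₂ (inj₂ (inj₂ (c , n′ , ψ , h , s , f _ r , k)))

  Decodes : M → M → M → Set ℓ
  Decodes m n φ = Triples.Derivable DecodeStep (m , n , φ)

  Decodes-eq : ∀ {m n c i j l l′} → HeadOf 0 m c → PairOf c i j → LevelOf n i l → LevelOf n j l′ →
               Decodes m n (tag₂ 2 (tag 0 l) (tag 0 l′))
  Decodes-eq hd p lv lv′ = Triples.derive DecodeStep-mono []
    (inj₁ (_ , _ , _ , _ , _ , _ , _ , p , lv , lv′ , tag-Tagged 0 _ , tag-Tagged 0 _ ,
      inj₁ (hd , tag₂-Tagged₂ 2 _ _)))

  Decodes-mem : ∀ {m n c i j l l′} → HeadOf 1 m c → PairOf c i j → LevelOf n i l → LevelOf n j l′ →
                Decodes m n (tag₂ 3 (tag 0 l) (tag 0 l′))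
  Decodes-mem hd p lv lv′ = Triples.derive DecodeStep-mono []
    (inj₁ (_ , _ , _ , _ , _ , _ , _ , p , lv , lv′ , tag-Tagged 0 _ , tag-Tagged 0 _ ,
      inj₂ (hd , tag₂-Tagged₂ 3 _ _)))

  Decodes-neg : ∀ {m n c ψ} → HeadOf 2 m c → Decodes c n ψ → Decodes m n (tag 4 ψ)
  Decodes-neg hd d = Triples.derive DecodeStep-mono (d ∷ [])
    (inj₂ (inj₁ (_ , _ , hd , here refl , tag-Tagged 4 _)))

  Decodes-or : ∀ {m n c a b ψ χ} → HeadOf 3 m c → PairOf c a b → Decodes a n ψ → Decodes b n χ →
               Decodes m n (tag₂ 5 ψ χ)
  Decodes-or hd p d d′ = Triples.derive DecodeStep-mono (d ∷ d′ ∷ [])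
    (inj₂ (inj₂ (inj₁ (_ , _ , _ , _ , _ , hd , p , here refl , there (here refl) ,
      tag₂-Tagged₂ 5 _ _))))

  Decodes-ex : ∀ {m n n′ c ψ} → HeadOf 4 m c → Succ 𝓜 n′ n → Decodes c n′ ψ →
               Decodes m n (tag₂ 6 n ψ)
  Decodes-ex hd s d = Triples.derive DecodeStep-mono (d ∷ [])
    (inj₂ (inj₂ (inj₂ (_ , _ , _ , hd , s , here refl , tag₂-Tagged₂ 6 _ _))))

  -- Here and in certificate-unique, m is kept abstract because the numeral of a
  -- concrete Cantor pair unfolds to a large term.
  code-Decodes : ∀ {n} (φ : LZF n) {m} → m ≡ code φ → Decodes (num m) (num n) (encode φ (vars n))
  code-Decodes {n} (i ≈̇ j) {m} eq with lookup-vars (vars n) i | lookup-vars (vars n) j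
  ... | l , eqᵢ , l< , _ | l′ , eqⱼ , l′< , _ =
    subst (Decodes (num m) (num n)) (sym (cong₂ (tag₂ 2) eqᵢ eqⱼ))
      (Decodes-eq (HeadOf-num 0 (pair (toℕ i) (toℕ j)) eq) (PairOf-num (toℕ i) (toℕ j) refl)
        (LevelOf-num (toℕ i) l l<) (LevelOf-num (toℕ j) l′ l′<))
  code-Decodes {n} (i ∈̇ j) {m} eq with lookup-vars (vars n) i | lookup-vars (vars n) j
  ... | l , eqᵢ , l< , _ | l′ , eqⱼ , l′< , _ =
    subst (Decodes (num m) (num n)) (sym (cong₂ (tag₂ 3) eqᵢ eqⱼ))
      (Decodes-mem (HeadOf-num 1 (pair (toℕ i) (toℕ j)) eq) (PairOf-num (toℕ i) (toℕ j) refl)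
        (LevelOf-num (toℕ i) l l<) (LevelOf-num (toℕ j) l′ l′<))
  code-Decodes (¬̇ φ) eq = Decodes-neg (HeadOf-num 2 (code φ) eq) (code-Decodes φ refl)
  code-Decodes (φ ∨̇ ψ) eq = Decodes-or (HeadOf-num 3 (pair (code φ) (code ψ)) eq)
    (PairOf-num (code φ) (code ψ) refl) (code-Decodes φ refl) (code-Decodes ψ refl)
  code-Decodes {n} (∃̇ φ) eq =
    Decodes-ex (HeadOf-num 4 (code φ) eq) (adjoin-Adjoin (num n) (num n)) (code-Decodes φ refl)

  DecodedAtom : ℕ → ℕ → ℕ → M → Set ℓ
  DecodedAtom k n c s = ∃[ i ] ∃[ j ] ∃[ l ] ∃[ l′ ]
    (c ≡ pair i j × suc (i + l) ≡ n × suc (j + l′) ≡ n ×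
     s ≡ tag₂ k (tag 0 (num l)) (tag 0 (num l′)))

  -- A case distinction on the external tag: as soon as injectivity of `pair` fixes the tag, the
  -- type computes to the single relevant clause.
  Decoded : (M × M × M → Set ℓ) → ℕ → M → ℕ → ℕ → Set ℓ
  Decoded R n s 0 c = DecodedAtom 2 n c s
  Decoded R n s 1 c = DecodedAtom 3 n c s
  Decoded R n s 2 c = ∃[ ψ ] (R (num c , num n , ψ) × s ≡ tag 4 ψ)
  Decoded R n s 3 c = ∃[ a ] ∃[ b ] ∃[ ψ ] ∃[ χ ]
    (c ≡ pair a b × R (num a , num n , ψ) × R (num b , num n , χ) × s ≡ tag₂ 5 ψ χ)
  Decoded R n s 4 c = ∃[ ψ ] (R (num c , num (suc n) , ψ) × s ≡ tag₂ 6 (num n) ψ)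
  Decoded R n s _ c = Lift ℓ ⊥

  -- From a standard code and context length, the bounds in `PairOf` and `LevelOf` admit only
  -- standard components, so an external recursion can continue with the premises.
  DecodeStep⇒Decoded : ∀ {R} m n {s} → DecodeStep R (num m , num n , s) →
                       ∃[ k ] ∃[ c ] (m ≡ pair k c × Decoded R n s k c)
  DecodeStep⇒Decoded m n
    (inj₁ (_ , _ , _ , _ , _ , _ , _ , p , lv , lv′ , tg , tg′ , inj₁ (hd , h)))
    with HeadOf⇒≡ 0 m hd
  ... | c , eq , refl with PairOf⇒≡ c p
  ... | i , j , eq′ , refl , refl with LevelOf⇒≡ n i lv | LevelOf⇒≡ n j lv′
  ... | l , l< , refl | l′ , l′< , refl = 0 , c , eq , i , j , l , l′ , eq′ , l< , l′< ,
    trans (Tagged₂⇒≡ h) (cong₂ (tag₂ 2) (Tagged⇒≡ tg) (Tagged⇒≡ tg′))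
  DecodeStep⇒Decoded m n
    (inj₁ (_ , _ , _ , _ , _ , _ , _ , p , lv , lv′ , tg , tg′ , inj₂ (hd , h)))
    with HeadOf⇒≡ 1 m hd
  ... | c , eq , refl with PairOf⇒≡ c p
  ... | i , j , eq′ , refl , refl with LevelOf⇒≡ n i lv | LevelOf⇒≡ n j lv′
  ... | l , l< , refl | l′ , l′< , refl = 1 , c , eq , i , j , l , l′ , eq′ , l< , l′< ,
    trans (Tagged₂⇒≡ h) (cong₂ (tag₂ 3) (Tagged⇒≡ tg) (Tagged⇒≡ tg′))
  DecodeStep⇒Decoded m n (inj₂ (inj₁ (_ , _ , hd , r , h))) with HeadOf⇒≡ 2 m hd
  ... | c , eq , refl = 2 , c , eq , _ , r , Tagged⇒≡ h
  DecodeStep⇒Decoded m n (inj₂ (inj₂ (inj₁ (_ , _ , _ , _ , _ , hd , p , r , r′ , h))))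
    with HeadOf⇒≡ 3 m hd
  ... | c , eq , refl with PairOf⇒≡ c p
  ... | a , b , eq′ , refl , refl = 3 , c , eq , a , b , _ , _ , eq′ , r , r′ , Tagged₂⇒≡ h
  DecodeStep⇒Decoded m n (inj₂ (inj₂ (inj₂ (_ , _ , _ , hd , s , r , h))))
    with HeadOf⇒≡ 4 m hd | Adjoin⇒≡ s
  ... | c , eq , refl | refl = 4 , c , eq , _ , r , Tagged₂⇒≡ h

  atom-unique : ∀ {n} (i j : Fin n) k {s} → DecodedAtom k n (pair (toℕ i) (toℕ j)) s →
                s ≡ tag₂ k (lookup (vars n) i) (lookup (vars n) j)
  atom-unique {n} i j k (i′ , j′ , l , l′ , eq , l< , l′< , refl)
    with pair-injective (toℕ i) (toℕ j) i′ j′ eq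
  -- Here `vars n` is merely a vector of length `n`; the equation between index, level and length
  -- determines both levels.
  ... | refl , refl with lookup-vars (vars n) i | lookup-vars (vars n) j
  ... | l₀ , eqᵢ , l₀< , _ | l₀′ , eqⱼ , l₀′< , _
    with +-cancelˡ-≡ (suc (toℕ i)) l l₀ (trans l< (sym l₀<))
       | +-cancelˡ-≡ (suc (toℕ j)) l′ l₀′ (trans l′< (sym l₀′<))
  ... | refl | refl = cong₂ (tag₂ k) (sym eqᵢ) (sym eqⱼ)

  certificate-unique : ∀ {g} → Triples.Certificate DecodeStep g → ∀ {n} (φ : LZF n) {m s} →
    m ≡ code φ → Triple∈ 𝓜 g (num m) (num n) s → s ≡ encode φ (vars n)
  certificate-unique C {n} (i ≈̇ j) {m} eq h with DecodeStep⇒Decoded m n (C _ h)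
  ... | k , c , eq′ , d
    with pair-injective 0 (pair (toℕ i) (toℕ j)) k c (trans (sym eq) eq′)
  ... | refl , refl = atom-unique i j 2 d
  certificate-unique C {n} (i ∈̇ j) {m} eq h with DecodeStep⇒Decoded m n (C _ h)
  ... | k , c , eq′ , d
    with pair-injective 1 (pair (toℕ i) (toℕ j)) k c (trans (sym eq) eq′)
  ... | refl , refl = atom-unique i j 3 d
  certificate-unique C {n} (¬̇ φ) {m} eq h with DecodeStep⇒Decoded m n (C _ h)
  ... | k , c , eq′ , d with pair-injective 2 (code φ) k c (trans (sym eq) eq′)
  ... | refl , refl with d
  ... | ψ , r , s≡ = trans s≡ (cong (tag 4) (certificate-unique C φ refl r))
  certificate-unique C {n} (φ ∨̇ ψ) {m} eq h with DecodeStep⇒Decoded m n (C _ h)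
  ... | k , c , eq′ , d with pair-injective 3 (pair (code φ) (code ψ)) k c (trans (sym eq) eq′)
  ... | refl , refl with d
  ... | a , b , _ , _ , eq″ , r , r′ , s≡ with pair-injective (code φ) (code ψ) a b eq″
  ... | refl , refl = trans s≡
    (cong₂ (tag₂ 5) (certificate-unique C φ refl r) (certificate-unique C ψ refl r′))
  certificate-unique C {n} (∃̇ φ) {m} eq h with DecodeStep⇒Decoded m n (C _ h)
  ... | k , c , eq′ , d with pair-injective 4 (code φ) k c (trans (sym eq) eq′)
  ... | refl , refl with d
  ... | ψ , r , s≡ = trans s≡ (cong (tag₂ 6 (num n)) (certificate-unique C φ refl r))

  Decodes-unique : ∀ {n} (φ : LZF n) {s} → Decodes (num (code φ)) (num n) s → s ≡ encode φ (vars n)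
  Decodes-unique φ (g , C , h) = certificate-unique C φ refl h

  module _ {c} {Y : Vec (Pred M ℓ) c} where

    Value₁ᵉ : ∀ {n} f (a y : Fin n) → Expressible Y (λ e → Value₁ f (e ! a) (e ! y))
    Value₁ᵉ f a y = ∃ᵉ (∃ᵉ (OPairᵉ x1 (2 ↑ʳ a) x0 ∧ᵉ Emptyᵉ x0 ∧ᵉ Graphᵉ f x1 (2 ↑ʳ y)))

    Value₂ᵉ : ∀ {n} f (a b y : Fin n) → Expressible Y (λ e → Value₂ f (e ! a) (e ! b) (e ! y))
    Value₂ᵉ f a b y = ∃ᵉ (∃ᵉ (∃ᵉ (OPairᵉ x2 (3 ↑ʳ a) x1 ∧ᵉ OPairᵉ x1 (3 ↑ʳ b) x0 ∧ᵉ
      Emptyᵉ x0 ∧ᵉ Graphᵉ f x2 (3 ↑ʳ y))))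

    PairOfᵉ : ∀ {n} (m a b : Fin n) → Expressible Y (λ e → PairOf (e ! m) (e ! a) (e ! b))
    PairOfᵉ m a b = ≼ᵉ a m ∧ᵉ ≼ᵉ b m ∧ᵉ Value₂ᵉ pairᴿ a b m

    HeadOfᵉ : ∀ {n} k (m d : Fin n) → Expressible Y (λ e → HeadOf k (e ! m) (e ! d))
    HeadOfᵉ k m d = ∃ᵉ (Numeralᵉ k x0 ∧ᵉ PairOfᵉ (1 ↑ʳ m) x0 (1 ↑ʳ d))

    LevelOfᵉ : ∀ {n} (k i l : Fin n) → Expressible Y (λ e → LevelOf (e ! k) (e ! i) (e ! l))
    LevelOfᵉ k i l = εᵉ l k ∧ᵉ ∃ᵉ (Succᵉ (1 ↑ʳ k) x0 ∧ᵉ Value₂ᵉ addᴿ (1 ↑ʳ i) (1 ↑ʳ l) x0)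

    DecodeStepᵉ : ∀ {n} (g m k φ : Fin n) → Expressible Y
      (λ e → DecodeStep (λ (a , b , s) → Triple∈ 𝓜 (e ! g) a b s) (e ! m , e ! k , e ! φ))
    DecodeStepᵉ g m k φ =
         ∃ᵉ (∃ᵉ (∃ᵉ (∃ᵉ (∃ᵉ (∃ᵉ (∃ᵉ (PairOfᵉ x6 x5 x4 ∧ᵉ LevelOfᵉ (7 ↑ʳ k) x5 x3 ∧ᵉ
           LevelOfᵉ (7 ↑ʳ k) x4 x2 ∧ᵉ Taggedᵉ 0 x1 x3 ∧ᵉ Taggedᵉ 0 x0 x2 ∧ᵉ
           ((HeadOfᵉ 0 (7 ↑ʳ m) x6 ∧ᵉ Tagged₂ᵉ 2 (7 ↑ʳ φ) x1 x0) ∨ᵉ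
            (HeadOfᵉ 1 (7 ↑ʳ m) x6 ∧ᵉ Tagged₂ᵉ 3 (7 ↑ʳ φ) x1 x0)))))))))
      ∨ᵉ ∃ᵉ (∃ᵉ (HeadOfᵉ 2 (2 ↑ʳ m) x1 ∧ᵉ Triple∈ᵉ (2 ↑ʳ g) x1 (2 ↑ʳ k) x0 ∧ᵉ
           Taggedᵉ 4 (2 ↑ʳ φ) x0))
      ∨ᵉ ∃ᵉ (∃ᵉ (∃ᵉ (∃ᵉ (∃ᵉ (HeadOfᵉ 3 (5 ↑ʳ m) x4 ∧ᵉ PairOfᵉ x4 x3 x2 ∧ᵉ
           Triple∈ᵉ (5 ↑ʳ g) x3 (5 ↑ʳ k) x1 ∧ᵉ Triple∈ᵉ (5 ↑ʳ g) x2 (5 ↑ʳ k) x0 ∧ᵉ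
           Tagged₂ᵉ 5 (5 ↑ʳ φ) x1 x0)))))
      ∨ᵉ ∃ᵉ (∃ᵉ (∃ᵉ (HeadOfᵉ 4 (3 ↑ʳ m) x2 ∧ᵉ Succᵉ x1 (3 ↑ʳ k) ∧ᵉ
           Triple∈ᵉ (3 ↑ʳ g) x2 x1 x0 ∧ᵉ Tagged₂ᵉ 6 (3 ↑ʳ φ) (3 ↑ʳ k) x0)))

    Decodesᵉ : ∀ {n} (m k φ : Fin n) → Expressible Y (λ e → Decodes (e ! m) (e ! k) (e ! φ))
    Decodesᵉ m k φ = respᵉ
      (λ e → mk⇔ (λ (g , C , h) → g , (λ (a , b , s) → C a b s) , h)
                 (λ (g , C , h) → g , (λ a b s → C (a , b , s)) , h))
      (∃ᵉ (∀ᵉ (∀ᵉ (∀ᵉ (Triple∈ᵉ x3 x2 x1 x0 ⇒ᵉ DecodeStepᵉ x3 x2 x1 x0))) ∧ᵉ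
           Triple∈ᵉ x0 (1 ↑ʳ m) (1 ↑ʳ k) (1 ↑ʳ φ)))

-- Realising recursive types

module Saturation {ℓ ℓ′} (em₀ : ExcludedMiddle 0ℓ) (em : ExcludedMiddle ℓ) (𝓜 : SetStructure ℓ)
  (𝔛 : Pred (Pred (SetStructure.Carrier 𝓜) ℓ) ℓ′) (gb : IsGB₀ 𝓜 𝔛)
  {k} (k-fin : FiniteOrdinal 𝓜 k) (k-ns : ¬ Standard 𝓜 k)
  {T} (T∈𝔛 : T ∈ 𝔛) (T-truth : IsDepthTruthClass 𝓜 k T) where

  open SetStructure 𝓜 renaming (Carrier to M)
  open Expressibility em 𝓜
  open Sets em 𝓜 𝔛 gb
  open Syntax em 𝓜 𝔛 gb
  open Nonstandard k-fin k-ns T∈𝔛 T-truth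
  open Representation em 𝓜 𝔛 gb
  open Decoding em 𝓜 𝔛 gb

  module _ {n} (p : Pred (LZF (suc n)) 0ℓ) (χ : Rec 1)
    (χ-decides : ∀ m → ((∃[ φ ] (φ ∈ p × code φ ≡ m)) → χ [ m ∷ [] ]⇓ 1) ×
                       (¬ (∃[ φ ] (φ ∈ p × code φ ≡ m)) → χ [ m ∷ [] ]⇓ 0))
    (a : Vec M n) where

    Code : ℕ → Set
    Code m = ∃[ φ ] (φ ∈ p × code φ ≡ m)

    InType : M → Set ℓ
    InType m = ∃[ o ] (Numeral 𝓜 1 o × Value₁ χ m o)

    Code⇒InType : ∀ {m} → Code m → InType (num m)
    Code⇒InType {m} h =
      num 1 , num-Numeral 1 , from (Value₁-num (proj₁ (χ-decides m) h)) refl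

    -- Finite satisfiability covers formulas of `p` only, so no other standard code may pass the
    -- test; the value 0 of `χ` off the type excludes them.
    InType⇒Code : ∀ {m} → InType (num m) → Code m
    InType⇒Code {m} (o , o≡1 , v) = em⇒dne em₀ λ ¬h →
      1≢0 (num-injective {1} {0} (trans (sym (Numeral⇒≡ 1 o≡1))
        (to (Value₁-num (proj₂ (χ-decides m) ¬h)) v)))
      where
        1≢0 : ¬ (1 ≡ 0)
        1≢0 ()

    -- Some x satisfies, according to T, all formulas of the type with code below N;
    -- here A = assignment a, i = n and s = n + 1.
    SatisfiedBelow : M → M → M → M → Set ℓ
    SatisfiedBelow A i s N = ∃[ x ] ∀ m → m ε N → InType m → ∀ φ → Decodes m s φ →
      ∀ q α r → OPair 𝓜 q i x → Adjoin 𝓜 α A q → Subst 𝓜 φ α r → r ∈ T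

    Satisfied : M → Set ℓ
    Satisfied = SatisfiedBelow (assignment a) (num n) (num (suc n))

    InTypeᵉ : ∀ {c n} {Y : Vec (Pred M ℓ) c} (m : Fin n) → Expressible Y (λ e → InType (e ! m))
    InTypeᵉ m = ∃ᵉ (Numeralᵉ 1 x0 ∧ᵉ Value₁ᵉ χ (1 ↑ʳ m) x0)

    SatisfiedBelowᵉ : ∀ {n} (A i s N : Fin n) →
      Expressible (T ∷ []) (λ e → SatisfiedBelow (e ! A) (e ! i) (e ! s) (e ! N))
    SatisfiedBelowᵉ A i s N = ∃ᵉ (∀ᵉ (εᵉ x0 (2 ↑ʳ N) ⇒ᵉ InTypeᵉ x0 ⇒ᵉ
      ∀ᵉ (Decodesᵉ x1 (3 ↑ʳ s) x0 ⇒ᵉ ∀ᵉ (∀ᵉ (∀ᵉ (OPairᵉ x2 (6 ↑ʳ i) x5 ⇒ᵉ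
        Adjoinᵉ x1 (6 ↑ʳ A) x2 ⇒ᵉ Substᵉ x3 x1 x0 ⇒ᵉ classᵉ x0 x0))))))

    -- The assignment, the index and the context length enter as set parameters, which leaves `T` as
    -- the only class parameter.
    Satisfied∈𝔛 : Satisfied ∈ 𝔛
    Satisfied∈𝔛 = expressible∈𝔛 3 (SatisfiedBelowᵉ x1 x2 x3 x0) (T∈𝔛 ∷ [])
      (assignment a , num n , num (suc n) , _)

    -- Excluded middle picks one formula for each code occurring in the type. One is enough:
    -- decoding is unique, so formulas with equal codes have equal encodings.
    formulas-below : ∀ N → ∃[ φs ] (All (_∈ p) φs × ∀ m → m < N → Code m →
                     ∃[ φ ] (φ ∈ˡ φs × code φ ≡ m))
    formulas-below zero    = [] , [] , λ _ ()
    formulas-below (suc N) with formulas-below N | em₀ {Code N}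
    ... | φs , φs⊆p , complete | no ¬h = φs , φs⊆p , complete′
      where
        complete′ : ∀ m → m < suc N → Code m → ∃[ φ ] (φ ∈ˡ φs × code φ ≡ m)
        complete′ m m<sN h with m≤n⇒m<n∨m≡n (s≤s⁻¹ m<sN)
        ... | inj₁ m<N  = complete m m<N h
        ... | inj₂ refl = contradiction h ¬h
    ... | φs , φs⊆p , complete | yes (ψ , ψ∈p , eq) = ψ ∷ φs , ψ∈p ∷ φs⊆p , complete′
      where
        complete′ : ∀ m → m < suc N → Code m → ∃[ φ ] (φ ∈ˡ ψ ∷ φs × code φ ≡ m)
        complete′ m m<sN h with m≤n⇒m<n∨m≡n (s≤s⁻¹ m<sN)
        ... | inj₂ refl = ψ , here refl , eq
        ... | inj₁ m<N with complete m m<N h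
        ... | φ , φ∈ , eq′ = φ , there φ∈ , eq′

    finite⇒Satisfied : (∀ (φs : List (LZF (suc n))) → All (_∈ p) φs →
      ∃[ x ] All (λ φ → Sat 𝓜 φ [] (x ∷ a)) φs) → ∀ N → Satisfied (num N)
    finite⇒Satisfied finite N with formulas-below N
    ... | φs , φs⊆p , complete with finite φs φs⊆p
    ... | x , sat = x , holds
      where
        decoded : ∀ m → m < N → Code m → ∀ φ′ → Decodes (num m) (num (suc n)) φ′ →
                  ∀ {r} → Subst 𝓜 φ′ (assignment (x ∷ a)) r → r ∈ T
        decoded m m<N h φ′ dec σ with complete m m<N h
        ... | φ , φ∈ , refl with Decodes-unique φ dec
        ... | refl = subst (_∈ T) (sym (to (Subst-assignment φ (x ∷ a)) σ))
                           (from (truth φ (x ∷ a)) (All.lookup sat φ∈))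
        holds : ∀ m → m ε num N → InType m → ∀ φ → Decodes m (num (suc n)) φ →
          ∀ q α r → OPair 𝓜 q (num n) x → Adjoin 𝓜 α (assignment a) q → Subst 𝓜 φ α r → r ∈ T
        holds m m∈N h φ dec q α r o A σ with ∈num N m∈N | OPair⇒≡ o
        ... | j , j<N , refl | refl with Adjoin⇒≡ A
        ... | refl = decoded j j<N (InType⇒Code h) φ dec σ

    Satisfied⇒realised : ∀ {N} → (∀ m → num m ε N) → Satisfied N →
                         ∃[ x ] (∀ φ → φ ∈ p → Sat 𝓜 φ [] (x ∷ a))
    Satisfied⇒realised N-ns (x , h) = x , λ φ φ∈p → to (truth φ (x ∷ a))
      (h (num (code φ)) (N-ns (code φ)) (Code⇒InType (φ , φ∈p , refl)) _ (code-Decodes φ refl)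
         _ _ _ (opair-OPair _ _) (adjoin-Adjoin _ _) (from (Subst-assignment φ (x ∷ a)) refl))

  recursivelySaturated : RecursivelySaturated 𝓜
  recursivelySaturated p (χ , χ-decides) a finite =
    let N , N-ns , sat = overspill k-fin {Satisfied p χ χ-decides a} k-ns
          (Satisfied∈𝔛 p χ χ-decides a) (finite⇒Satisfied p χ χ-decides a finite)
    in Satisfied⇒realised p χ χ-decides a N-ns sat

theorem3p7 : ∀ {ℓ ℓ′} → ExcludedMiddle (lsuc ℓ ⊔ ℓ′) →
    (𝓜 : SetStructure ℓ) (𝔛 : Pred (Pred (SetStructure.Carrier 𝓜) ℓ) ℓ′) →
    IsGB⁺∞ 𝓜 𝔛 ⊎ IsGB⁻∞ 𝓜 𝔛 →
    ωNonstandard 𝓜 →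
    (𝔛 ≐ Definable 𝓜 → C-Most 𝓜 𝔛 ≐ Standard 𝓜) ×
    (¬ RecursivelySaturated 𝓜 → C-Most 𝓜 𝔛 ≐ Standard 𝓜)
theorem3p7 {ℓ} {ℓ′} em₊ 𝓜 𝔛 gb± _ =
    (λ (𝔛⊆Def , _) →
      (λ (k-fin , T , T∈𝔛 , T-truth) → em⇒dne em λ k-ns →
        let open Nonstandard k-fin k-ns T∈𝔛 T-truth
        in Diagonal-undefinable (𝔛⊆Def Diagonal∈𝔛)) ,
      Standard⊆C-Most)
  , (λ ¬saturated →
      (λ (k-fin , T , T∈𝔛 , T-truth) → em⇒dne em λ k-ns →
        ¬saturated (recursivelySaturated em₀ em 𝓜 𝔛 gb k-fin k-ns T∈𝔛 T-truth)) ,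
      Standard⊆C-Most)
  where
    em : ExcludedMiddle ℓ
    em = lower-em (lsuc ℓ ⊔ ℓ′) em₊
    em₀ : ExcludedMiddle 0ℓ
    em₀ = lower-em (lsuc ℓ ⊔ ℓ′) em₊
    gb : IsGB₀ 𝓜 𝔛
    gb = [ proj₁ , proj₁ ]′ gb±
    open Syntax em 𝓜 𝔛 gb
    open StandardTruth em 𝓜 𝔛 gb
    open Saturation
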